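{- Let $k\geq 3$. For every $d\in(0,1]$ there is an $\ell\in\mathbb N$ such that $$\frac{1}{2(k-1)^{\ell}}\leq\gamma(Z^{(k)}_\ell)\leq d.$$
   Context: A $k$-graph $H$ has vertex set $V(H)$ and edge set $E(H)$ consisting of $k$-subsets of $V(H)$. The minimum codegree $\delta(H)$ is the minimum, over all $(k-1)$-subsets $S\subseteq V(H)$, of the number of edges containing $S$. For a $k$-graph $F$, $\mathrm{ex}_{\mathrm{co}}(n,F)$ is the maximum $d$ such that some $n$-vertex $k$-graph with no copy of $F$ has $\delta\geq d$, and $\gamma(F)=\lim_{n\to\infty}\mathrm{ex}_{\mathrm{co}}(n,F)/n$. For integers $\ell\geq 2$, $k\geq 2$, the $k$-uniform zycle of length $\ell$, $Z^{(k)}_\ell$, is the $k$-graph with vertex set $\{v_i^j: i\in[\ell], j\in[k-1]\}$ and edge set $\{\{v_i^1,v_i^2,\dots,v_i^{k-1},v_{i+1}^j\}: i\in[\ell], j\in[k-1]\}$, where indices $i$ are taken modulo $\ell$. -}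

module Defs where

open import Data.Nat as ℕ using (ℕ; zero; suc; _∸_; _^_)
open import Data.Nat.DivMod using (_mod_)
open import Data.Bool using (Bool; true; false; if_then_else_)
open import Data.Fin using (Fin; toℕ)
open import Data.Fin.Subset using (Subset; ⁅_⁆; _∪_; ⊥; ∣_∣)
open import Data.List using (List; _∷_; []; map; foldr; allFin)
open import Data.Nat.ListAction using (sum)
open import Relation.Nullary using (¬_)
open import Data.Product using (Σ; ∃-syntax)
open import Data.Product using (_×_; _,_)
open import Data.Integer using (+_)
open import Data.Rational using (ℚ; _/_; 0ℚ; _+_; _-_; _*_; _<_; _≤_)
open import Relation.Binary.PropositionalEquality using (_≡_)
open import Function.Definitions using (Injective)

toℚ : ℕ → ℚ
toℚ n = + n / 1

record KGraph (k n : ℕ) : Set where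
  field
    edge    : Subset n → Bool
    uniform : ∀ e → edge e ≡ true → ∣ e ∣ ≡ k
open KGraph public

-- number of edges containing the set S (meant for |S| = k-1):
-- the number of vertices v with S ∪ {v} an edge (v ∈ S is impossible by uniformity)
codeg : ∀ {k n} → KGraph k n → Subset n → ℕ
codeg {n = n} H S = sum (map (λ v → if edge H (⁅ v ⁆ ∪ S) then 1 else 0) (allFin n))

δ≥ : ∀ {k n} → KGraph k n → ℕ → Set
δ≥ {k} H D = ∀ S → ∣ S ∣ ≡ k ∸ 1 → D ℕ.≤ codeg H S

toSubset : ∀ {n} → List (Fin n) → Subset n
toSubset = foldr (λ x s → ⁅ x ⁆ ∪ s) ⊥

next : ∀ {ℓ} → Fin ℓ → Fin ℓ
next {suc m} i = suc (toℕ i) mod (suc m)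

-- The zycle Z^(k)_ℓ: vertices v_i^j = (i , j), i ∈ Fin ℓ, j ∈ Fin (k-1);
-- edges {v_i^1,…,v_i^{k-1}, v_{i+1}^j} for i ∈ Fin ℓ, j ∈ Fin (k-1).
ZVertex : ℕ → ℕ → Set
ZVertex k ℓ = Fin ℓ × Fin (k ∸ 1)

zycleEdge : ∀ {k ℓ} → Fin ℓ → Fin (k ∸ 1) → List (ZVertex k ℓ)
zycleEdge {k} i j = (next i , j) ∷ map (λ t → (i , t)) (allFin (k ∸ 1))

ContainsZycle : ∀ {k n} → ℕ → KGraph k n → Set
ContainsZycle {k} {n} ℓ H =
  Σ (ZVertex k ℓ → Fin n) λ φ →
    Injective _≡_ _≡_ φ × (∀ i j → edge H (toSubset (map φ (zycleEdge {k} {ℓ} i j))) ≡ true)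

ZycleFree : ∀ {k n} → ℕ → KGraph k n → Set
ZycleFree ℓ H = ¬ ContainsZycle ℓ H

-- the rational 1 / (2 (k-1)^ℓ)  (denominator nonzero whenever k ≥ 2)
lowerBound : ℕ → ℕ → ℚ
lowerBound k ℓ with 2 ℕ.* (k ∸ 1) ^ ℓ
... | zero  = 0ℚ
... | suc m = + 1 / suc m

-- γ(Z^(k)_ℓ) ≤ d, i.e. limsup ex_co(n, Z)/n ≤ d:
-- for every ε > 0, for all large n, every Z-free n-vertex k-graph H has δ(H) ≤ (d + ε) n.
γ≤ : ℕ → ℕ → ℚ → Set
γ≤ k ℓ d = ∀ ε → 0ℚ < ε → ∃[ N ] ∀ n → N ℕ.≤ n →
  (H : KGraph k n) → ZycleFree ℓ H → ∀ D → δ≥ H D → toℚ D ≤ (d + ε) * toℚ n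

-- c ≤ γ(Z^(k)_ℓ), i.e. liminf ex_co(n, Z)/n ≥ c:
-- for every ε > 0, for all large n, some Z-free n-vertex k-graph H has δ(H) ≥ (c - ε) n.
γ≥ : ℕ → ℕ → ℚ → Set
γ≥ k ℓ c = ∀ ε → 0ℚ < ε → ∃[ N ] ∀ n → N ℕ.≤ n →
  Σ (KGraph k n) λ H → ZycleFree ℓ H × ∃[ D ] (δ≥ H D × (c - ε) * toℚ n ≤ toℚ D)

{-# OPTIONS --safe #-}
-- Write r = k − 1 and ℓ = 2 · t!.
--
-- Lower bound: put M = r^ℓ − 1 and let a k-set of vertices be an edge when its sum is ≡ 1 modulo M.  Every r-set then
-- extends in about n / M ways.  In a copy of the zycle the row sums a_i satisfy a_{i+1} ≡ r − r a_i (mod M), so the numbers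
-- c_i = k a_i − r satisfy c_{i+1} ≡ − r c_i (mod k M); going around, k M divides (r^ℓ − 1) c_0 = M c_0, so k divides r.
--
-- Upper bound: suppose every r-set has at least n / q neighbours.  In the digraph on r-tuples with u → w when every
-- vertex of w is a neighbour of u, out-degrees are at least a fraction q^{-r} of all tuples.  For a suitable t depending
-- only on q^r, at least half of the samples of t tuples have no tuple without an out-neighbour in the sample, so a fixed
-- fixed-point-free f : [t] → [t] satisfies x_i → x_{f i} (i ∈ [t]) for a positive proportion of all x.  As a subset of
-- V^{t r} of positive density contains a large box, each tuple of such a sample can be blown up.  Finally, f has a cycle
-- of length at most t, whose length divides ℓ, and winding around it inside the box gives the zycle of length ℓ.
module Submission where

open import Defs
open import Data.Bool using (Bool; true; false; T; not; _∧_; _∨_; if_then_else_)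
open import Data.Bool.Properties using (not-injective; ¬-not; ∨-identityʳ; ∨-zeroʳ) renaming (_≟_ to _≟ᵇ_)
open import Data.Fin using (Fin; zero; suc; toℕ; combine; remQuot)
open import Data.Fin.Properties using (toℕ-fromℕ<; toℕ<n; toℕ-injective; remQuot-combine; combine-injective)
  renaming (_≟_ to _≟ᶠ_; any? to anyᶠ?; all? to allᶠ?; pigeonhole to pigeonholeᶠ)
open import Data.Fin.Subset using (Subset; ⁅_⁆; _∪_; ⊥; ∣_∣; inside; outside) renaming (_∈_ to _∈ˢ_; _∉_ to _∉ˢ_)
open import Data.Fin.Subset.Properties using (∪-identityˡ; x∈p∪q⁻; x∈⁅y⁆⇒x≡y; ∉⊥)
open import Data.Integer as ℤ using (ℤ; -[1+_]) renaming (+_ to ⁺_)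
import Data.Integer.Divisibility.Signed as ℤ
import Data.Integer.Properties as ℤ
import Data.Integer.Solver as ℤ
open import Data.List using (List; []; _∷_; _++_; map; length; cartesianProductWith; allFin; filter; take)
open import Data.List.Membership.Propositional using (_∈_; _∉_)
import Data.List.Membership.DecPropositional as DecMembership
open import Data.List.Membership.Propositional.Properties using (∈-cartesianProductWith⁺; ∈-++⁺ˡ; ∈-++⁺ʳ; ∈-allFin)
open import Data.List.Properties using (map-++; map-∘; map-cong; map-tabulate; length-map; length-++; length-take; length-tabulate)
open import Data.List.Relation.Unary.All as All using (All; []; _∷_)
import Data.List.Relation.Unary.All.Properties as All
open import Data.List.Relation.Unary.AllPairs using ([]; _∷_)
open import Data.List.Relation.Unary.Any using (here; there)
open import Data.List.Relation.Unary.Unique.Propositional using (Unique)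
import Data.List.Relation.Unary.Unique.Propositional.Properties as Unique
open import Data.Nat
open import Data.Nat.Divisibility using (_∣_; divides; ∣-trans; ∣-refl; ∣m∣n⇒∣m+n; ∣⇒≤; m∣m*n; m≤n⇒m!∣n!; _∣0; _∣?_)
open import Data.Nat.DivMod
  using (_mod_; m%n<n; m/n*n≤m; m≡m%n+[m/n]*n; m<n⇒m%n≡m; n%n≡0; %-distribˡ-+; m%n%n≡m%n; /-monoˡ-≤; m*n/n≡m)
open import Data.Nat.GeneralisedArithmetic using (fold; fold-+)
open import Data.Nat.ListAction using (sum)
open import Data.Nat.ListAction.Properties using (sum-++)
open import Data.Nat.Properties
open import Data.Nat.Solver using (module +-*-Solver)
open import Data.Product using (Σ-syntax; ∃-syntax; _×_; _,_; proj₁; proj₂; map₁)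
open import Data.Rational as ℚ using (ℚ; mkℚ; 0ℚ; 1ℚ) renaming (_<_ to _<ℚ_; _≤_ to _≤ℚ_)
import Data.Rational.Properties as ℚ
open import Data.Rational.Unnormalised as ℚᵘ using (mkℚᵘ; *≤*)
import Data.Rational.Unnormalised.Properties as ℚᵘ
open import Data.Sum using (inj₁; inj₂)
open import Data.Vec as Vec using (Vec; []; _∷_; lookup; tabulate; toList) renaming (_++_ to _++ᵛ_)
open import Data.Vec.Membership.Propositional.Properties using (∈-toList⁺; ∈-lookup)
open import Data.Vec.Properties
  using (lookup∘tabulate; tabulate∘lookup; tabulate-cong; lookup-++ˡ; lookup-++ʳ; length-toList; []=⇒lookup)
import Data.Vec.Relation.Unary.All as VecAll
open VecAll using ([]; _∷_)
open import Data.Vec.Relation.Unary.AllPairs using ([]; _∷_)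
import Data.Vec.Relation.Unary.Unique.Propositional as VecUnique
import Data.Vec.Relation.Unary.Unique.Propositional.Properties as VecUnique
open import Function using (_∘_)
open import Function.Definitions using (Injective)
open import Relation.Binary.PropositionalEquality
open import Relation.Nullary
open import Relation.Nullary.Decidable using (_×-dec_; ¬?; dec-true; dec-false; T?)
open import Relation.Unary using (Decidable)

private variable
  A A′ : Set
  n : ℕ

-- Finite sums and counting

∑ : List A → (A → ℕ) → ℕ
∑ xs f = sum (map f xs)

𝟙 : Bool → ℕ
𝟙 b = if b then 1 else 0

# : List A → (A → Bool) → ℕ
# xs p = ∑ xs (𝟙 ∘ p)

∑-cong : ∀ (xs : List A) {f g} → f ≗ g → ∑ xs f ≡ ∑ xs g
∑-cong []       e = refl
∑-cong (x ∷ xs) e = cong₂ _+_ (e x) (∑-cong xs e)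

∑-mono : ∀ (xs : List A) {f g} → (∀ x → f x ≤ g x) → ∑ xs f ≤ ∑ xs g
∑-mono []       le = z≤n
∑-mono (x ∷ xs) le = +-mono-≤ (le x) (∑-mono xs le)

∑-+ : ∀ (xs : List A) f g → ∑ xs (λ x → f x + g x) ≡ ∑ xs f + ∑ xs g
∑-+ []       f g = refl
∑-+ (x ∷ xs) f g rewrite ∑-+ xs f g =
  solve 4 (λ a b c d → (a :+ b) :+ (c :+ d) := (a :+ c) :+ (b :+ d)) refl (f x) (g x) (∑ xs f) (∑ xs g)
  where open +-*-Solver

∑-*ˡ : ∀ (xs : List A) c f → ∑ xs (λ x → c * f x) ≡ c * ∑ xs f
∑-*ˡ []       c f = sym (*-zeroʳ c)
∑-*ˡ (x ∷ xs) c f rewrite ∑-*ˡ xs c f = sym (*-distribˡ-+ c (f x) (∑ xs f))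

∑-const : ∀ (xs : List A) c → ∑ xs (λ _ → c) ≡ length xs * c
∑-const []       c = refl
∑-const (x ∷ xs) c = cong (c +_) (∑-const xs c)

∑-swap : ∀ (xs : List A) (ys : List A′) (f : A → A′ → ℕ) →
  ∑ xs (λ x → ∑ ys (f x)) ≡ ∑ ys (λ y → ∑ xs (λ x → f x y))
∑-swap []       ys f = sym (trans (∑-const ys 0) (*-zeroʳ (length ys)))
∑-swap (x ∷ xs) ys f rewrite ∑-swap xs ys f = sym (∑-+ ys (f x) _)

∑-map : ∀ (g : A → A′) xs (f : A′ → ℕ) → ∑ (map g xs) f ≡ ∑ xs (f ∘ g)
∑-map g xs f = cong sum (sym (map-∘ xs))

∑-++ : ∀ (xs ys : List A) f → ∑ (xs ++ ys) f ≡ ∑ xs f + ∑ ys f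
∑-++ xs ys f rewrite map-++ f xs ys = sum-++ (map f xs) (map f ys)

∈⇒≤∑ : ∀ {x : A} {xs} f → x ∈ xs → f x ≤ ∑ xs f
∈⇒≤∑ f (here refl) = m≤m+n _ _
∈⇒≤∑ f (there x∈)  = m≤n⇒m≤o+n _ (∈⇒≤∑ f x∈)

∑-bounded : ∀ (xs : List A) {f} c → (∀ x → f x ≤ c) → ∑ xs f ≤ length xs * c
∑-bounded xs c le = ≤-trans (∑-mono xs le) (≤-reflexive (∑-const xs c))

#+#not : ∀ (xs : List A) p → # xs p + # xs (not ∘ p) ≡ length xs
#+#not xs p = begin
  # xs p + # xs (not ∘ p)                   ≡⟨ ∑-+ xs _ _ ⟨
  ∑ xs (λ x → 𝟙 (p x) + 𝟙 (not (p x)))      ≡⟨ ∑-cong xs (λ x → 𝟙+𝟙not (p x)) ⟩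
  ∑ xs (λ _ → 1)                            ≡⟨ ∑-const xs 1 ⟩
  length xs * 1                             ≡⟨ *-identityʳ _ ⟩
  length xs                                 ∎
  where
  open ≡-Reasoning
  𝟙+𝟙not : ∀ b → 𝟙 b + 𝟙 (not b) ≡ 1
  𝟙+𝟙not false = refl
  𝟙+𝟙not true  = refl

𝟙-∧ : ∀ a b → 𝟙 (a ∧ b) ≡ 𝟙 a * 𝟙 b
𝟙-∧ false b = refl
𝟙-∧ true  b = sym (*-identityˡ _)

𝟙≤1 : ∀ b → 𝟙 b ≤ 1
𝟙≤1 false = z≤n
𝟙≤1 true  = ≤-refl

#≤length : ∀ (xs : List A) p → # xs p ≤ length xs
#≤length xs p = ≤-trans (∑-bounded xs 1 (𝟙≤1 ∘ p)) (≤-reflexive (*-identityʳ _))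

pigeonhole : ∀ (xs : List A) f → 0 < ∑ xs f →
  ∃[ x ] (x ∈ xs × ∑ xs f ≤ length xs * f x)
pigeonhole (x ∷ [])       f _   = x , here refl , ≤-refl
pigeonhole (x ∷ y ∷ ys) f pos = go (pigeonhole′ y ys)
  where
  pigeonhole′ : ∀ y ys → ∃[ z ] (z ∈ y ∷ ys × ∑ (y ∷ ys) f ≤ length (y ∷ ys) * f z)
  pigeonhole′ y [] = y , here refl , ≤-refl
  pigeonhole′ y (y′ ∷ ys) with pigeonhole′ y′ ys
  ... | z , z∈ , le with ≤-total (f y) (f z)
  ...   | inj₁ y≤z = z , there z∈ , +-mono-≤ y≤z le
  ...   | inj₂ z≤y = y , here refl , +-monoʳ-≤ (f y) (≤-trans le (*-monoʳ-≤ (length (y′ ∷ ys)) z≤y))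
  go : _ → _
  go (z , z∈ , le) with ≤-total (f x) (f z)
  ... | inj₁ x≤z = z , there z∈ , +-mono-≤ x≤z le
  ... | inj₂ z≤x = x , here refl , +-monoʳ-≤ (f x) (≤-trans le (*-monoʳ-≤ (length (y ∷ ys)) z≤x))

-- An averaging argument: where `f` is below the threshold, `2 * c * f x` is at most `X`, and
-- elsewhere it is at most `2 * c * X`. Summed up, the first contribution is at most half of
-- `2 * c * ∑ xs f`, so the second must make up the other half.
reverse-Markov : ∀ (xs : List A) (f : A → ℕ) X c .{{_ : NonZero X}} → (∀ x → f x ≤ X) →
  length xs * X ≤ c * ∑ xs f →
  length xs ≤ 2 * c * # xs (λ x → X ≤ᵇ 2 * c * f x)
reverse-Markov xs f X c f≤X dense = *-cancelʳ-≤ _ _ X (+-cancelʳ-≤ (length xs * X) _ _ (begin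
  length xs * X + length xs * X           ≤⟨ +-mono-≤ dense dense ⟩
  c * ∑ xs f + c * ∑ xs f                 ≡⟨ solve 2 (λ c s → c :* s :+ c :* s := con 2 :* c :* s) refl c (∑ xs f) ⟩
  2 * c * ∑ xs f                          ≡⟨ ∑-*ˡ xs (2 * c) f ⟨
  ∑ xs (λ x → 2 * c * f x)                ≤⟨ ∑-mono xs pointwise ⟩
  ∑ xs (λ x → 2 * c * X * h x + X)        ≡⟨ ∑-+ xs _ _ ⟩
  ∑ xs (λ x → 2 * c * X * h x) + ∑ xs (λ _ → X)
                                          ≡⟨ cong₂ _+_ (∑-*ˡ xs (2 * c * X) h) (∑-const xs X) ⟩
  2 * c * X * ∑ xs h + length xs * X      ≡⟨ cong (_+ length xs * X)
      (solve 3 (λ c X s → con 2 :* c :* X :* s := con 2 :* c :* s :* X) refl c X (∑ xs h)) ⟩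
  2 * c * ∑ xs h * X + length xs * X      ∎))
  where
  open ≤-Reasoning
  open +-*-Solver
  h : _ → ℕ
  h x = 𝟙 (X ≤ᵇ 2 * c * f x)
  pointwise : ∀ x → 2 * c * f x ≤ 2 * c * X * h x + X
  pointwise x with X ≤ᵇ 2 * c * f x in eq
  ... | true  = ≤-trans (*-monoʳ-≤ (2 * c) (f≤X x))
                  (≤-trans (≤-reflexive (sym (*-identityʳ _))) (m≤m+n _ X))
  ... | false = ≤-trans (≰⇒≥ (subst T eq ∘ ≤⇒≤ᵇ)) (m≤n+m X _)

-- Tuples over a list

vecs : List A → ∀ m → List (Vec A m)
vecs xs zero    = [] ∷ []
vecs xs (suc m) = cartesianProductWith _∷_ xs (vecs xs m)

∑-vecs-suc : ∀ (xs : List A) m f →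
  ∑ (vecs xs (suc m)) f ≡ ∑ xs (λ x → ∑ (vecs xs m) (λ v → f (x ∷ v)))
∑-vecs-suc {A} xs m f = go xs
  where
  go : ∀ ys → ∑ (cartesianProductWith _∷_ ys (vecs xs m)) f ≡ ∑ ys (λ x → ∑ (vecs xs m) (λ v → f (x ∷ v)))
  go []       = refl
  go (y ∷ ys) = trans (∑-++ (map (y ∷_) (vecs xs m)) _ f) (cong₂ _+_ (∑-map (y ∷_) (vecs xs m) f) (go ys))

length≡∑1 : ∀ (xs : List A) → length xs ≡ ∑ xs (λ _ → 1)
length≡∑1 xs = sym (trans (∑-const xs 1) (*-identityʳ _))

length-vecs : ∀ (xs : List A) m → length (vecs xs m) ≡ length xs ^ m
length-vecs xs zero    = refl
length-vecs xs (suc m) = begin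
  length (vecs xs (suc m))                  ≡⟨ length≡∑1 (vecs xs (suc m)) ⟩
  ∑ (vecs xs (suc m)) (λ _ → 1)             ≡⟨ ∑-vecs-suc xs m _ ⟩
  ∑ xs (λ _ → ∑ (vecs xs m) (λ _ → 1))      ≡⟨ ∑-const xs _ ⟩
  length xs * ∑ (vecs xs m) (λ _ → 1)       ≡⟨ cong (length xs *_) (trans (sym (length≡∑1 (vecs xs m))) (length-vecs xs m)) ⟩
  length xs * length xs ^ m                 ∎
  where open ≡-Reasoning

∈-vecs : ∀ {xs : List A} → (∀ x → x ∈ xs) → ∀ {m} (v : Vec A m) → v ∈ vecs xs m
∈-vecs all []      = here refl
∈-vecs all (x ∷ v) = ∈-cartesianProductWith⁺ _∷_ (all x) (∈-vecs all v)

allᵛ : (A → Bool) → ∀ {m} → Vec A m → Bool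
allᵛ p []      = true
allᵛ p (x ∷ v) = p x ∧ allᵛ p v

#-allᵛ : ∀ (xs : List A) p m → # (vecs xs m) (allᵛ p) ≡ # xs p ^ m
#-allᵛ xs p zero    = refl
#-allᵛ xs p (suc m) = begin
  # (vecs xs (suc m)) (allᵛ p)                             ≡⟨ ∑-vecs-suc xs m _ ⟩
  ∑ xs (λ x → ∑ (vecs xs m) (λ v → 𝟙 (p x ∧ allᵛ p v)))    ≡⟨ ∑-cong xs (λ x → ∑-cong (vecs xs m) (λ v → 𝟙-∧ (p x) _)) ⟩
  ∑ xs (λ x → ∑ (vecs xs m) (λ v → 𝟙 (p x) * 𝟙 (allᵛ p v))) ≡⟨ ∑-cong xs (λ x → trans (∑-*ˡ (vecs xs m) (𝟙 (p x)) _) (*-comm (𝟙 (p x)) _)) ⟩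
  ∑ xs (λ x → # (vecs xs m) (allᵛ p) * 𝟙 (p x))            ≡⟨ ∑-*ˡ xs (# (vecs xs m) (allᵛ p)) _ ⟩
  # (vecs xs m) (allᵛ p) * # xs p                          ≡⟨ *-comm _ (# xs p) ⟩
  # xs p * # (vecs xs m) (allᵛ p)                          ≡⟨ cong (# xs p *_) (#-allᵛ xs p m) ⟩
  # xs p * # xs p ^ m                                      ∎
  where open ≡-Reasoning

-- Sampling in a dense digraph

allᵛ-false : ∀ (p : A → Bool) {m} (v : Vec A m) → allᵛ p v ≡ false → ∃[ j ] p (lookup v j) ≡ false
allᵛ-false p (x ∷ v) eq with p x in px
... | false = zero , px
... | true  with j , pj ← allᵛ-false p v eq = suc j , pj

n<2^n : ∀ n → n < 2 ^ n
n<2^n zero    = ≤-refl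
n<2^n (suc n) = begin-strict
  suc n              ≤⟨ n<2^n n ⟩
  2 ^ n              <⟨ m<m+n (2 ^ n) (≤-trans (s≤s z≤n) (n<2^n n)) ⟩
  2 ^ n + 2 ^ n      ≡⟨ cong (2 ^ n +_) (+-identityʳ _) ⟨
  2 ^ suc n          ∎
  where open ≤-Reasoning

-- Bernoulli's inequality (1 + 1/P)^m ≥ 1 + m/P, multiplied through by P · P^m.
Bernoulli : ∀ P m → (P + m) * P ^ m ≤ P * suc P ^ m
Bernoulli P zero    = ≤-reflexive (cong (_* 1) (+-identityʳ P))
Bernoulli P (suc m) = begin
  (P + suc m) * (P * P ^ m)              ≤⟨ m≤m+n _ (m * P ^ m) ⟩
  (P + suc m) * (P * P ^ m) + m * P ^ m  ≡⟨ solve 3 (λ P m e → (P :+ (con 1 :+ m)) :* (P :* e) :+ m :* e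
                                              := (con 1 :+ P) :* ((P :+ m) :* e)) refl P m (P ^ m) ⟩
  suc P * ((P + m) * P ^ m)              ≤⟨ *-monoʳ-≤ (suc P) (Bernoulli P m) ⟩
  suc P * (P * suc P ^ m)                ≡⟨ solve 2 (λ P e → (con 1 :+ P) :* (P :* e) := P :* ((con 1 :+ P) :* e)) refl P (suc P ^ m) ⟩
  P * (suc P * suc P ^ m)                ∎
  where open ≤-Reasoning; open +-*-Solver

linear-below-exponential : ∀ P → ∃[ j ] 2 * suc (P * j) ≤ 2 ^ j
linear-below-exponential P = a + a , (begin
  2 * suc (P * (a + a))                    ≤⟨ m≤m+n _ _ ⟩
  2 * suc (P * (a + a)) + (4 * (P + a) + 2) ≡⟨ expand P a ⟩
  4 * suc P * suc a                        ≤⟨ *-mono-≤ (*-monoʳ-≤ 4 (n<2^n P)) (n<2^n a) ⟩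
  4 * 2 ^ P * 2 ^ a                        ≡⟨ cong (_* 2 ^ a) (^-distribˡ-+-* 2 2 P) ⟨
  2 ^ a * 2 ^ a                            ≡⟨ ^-distribˡ-+-* 2 a a ⟨
  2 ^ (a + a)                              ∎)
  where
  open ≤-Reasoning
  -- With this choice 4 · 2^P = 2^a, so the product of the two exponential bounds is exactly 2^(a +
  -- a).
  a = 2 + P
  expand : ∀ P a → 2 * suc (P * (a + a)) + (4 * (P + a) + 2) ≡ 4 * suc P * suc a
  expand = solve 2 (λ P a → con 2 :* (con 1 :+ P :* (a :+ a)) :+ (con 4 :* (P :+ a) :+ con 2)
                         := con 4 :* (con 1 :+ P) :* (con 1 :+ a)) refl
    where open +-*-Solver

^-distribʳ-* : ∀ m n k → (m * n) ^ k ≡ m ^ k * n ^ k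
^-distribʳ-* m n zero    = refl
^-distribʳ-* m n (suc k) rewrite ^-distribʳ-* m n k =
  solve 4 (λ m n x y → m :* n :* (x :* y) := m :* x :* (n :* y)) refl m n (m ^ k) (n ^ k)
  where open +-*-Solver

-- The inequality behind the union bound over s + 1 positions: an event of probability at most (P/(P
-- + 1))^s must have probability at most 1/(2(s + 1)). With s = P j, the power (1 + 1/P)^s is at
-- least 2^j, which outgrows the linear factor.
sample-size : ∀ P .{{_ : NonZero P}} → ∃[ s ] 2 * suc s * P ^ s ≤ suc P ^ s
sample-size P = P * j , (begin
  2 * suc (P * j) * P ^ (P * j)   ≤⟨ *-monoˡ-≤ _ (proj₂ (linear-below-exponential P)) ⟩
  2 ^ j * P ^ (P * j)             ≡⟨ cong (2 ^ j *_) (^-*-assoc P P j) ⟨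
  2 ^ j * (P ^ P) ^ j             ≡⟨ ^-distribʳ-* 2 (P ^ P) j ⟨
  (2 * P ^ P) ^ j                 ≤⟨ ^-monoˡ-≤ j doubling ⟩
  (suc P ^ P) ^ j                 ≡⟨ ^-*-assoc (suc P) P j ⟩
  suc P ^ (P * j)                 ∎)
  where
  open ≤-Reasoning
  open +-*-Solver
  j = proj₁ (linear-below-exponential P)
  -- Bernoulli's inequality at m = P.
  doubling : 2 * P ^ P ≤ suc P ^ P
  doubling = *-cancelˡ-≤ P (≤-trans
    (≤-reflexive (solve 2 (λ P e → P :* (con 2 :* e) := (P :+ P) :* e) refl P (P ^ P))) (Bernoulli P P))

module Sampling (E : A → A → Bool) where

  -- The entry at position i has no arc to an entry at any other position. The recursion on the head
  -- never compares a position with itself, so loops of `E` do not count.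
  isolated : ∀ {m} → Fin m → Vec A m → Bool
  isolated zero    (a ∷ x) = allᵛ (not ∘ E a) x
  isolated (suc i) (a ∷ x) = isolated i x ∧ not (E (lookup x i) a)

  not-isolated : ∀ {m} (i : Fin m) x → isolated i x ≡ false →
    ∃[ j ] i ≢ j × E (lookup x i) (lookup x j) ≡ true
  not-isolated zero (a ∷ x) eq with j , e ← allᵛ-false (not ∘ E a) x eq =
    suc j , (λ ()) , not-injective e
  not-isolated (suc i) (a ∷ x) eq with isolated i x in iso
  ... | true  = zero , (λ ()) , not-injective eq
  ... | false with j , i≢j , e ← not-isolated i x iso = suc j , (λ { refl → i≢j refl }) , e

  module _ (xs : List A) (P : ℕ) (dense : ∀ a → length xs ≤ suc P * # xs (E a)) where

    private
      M = length xs
      non : A → ℕ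
      non a = # xs (not ∘ E a)

    sparse-complement : ∀ a → suc P * non a ≤ P * M
    sparse-complement a = +-cancelʳ-≤ (suc P * # xs (E a)) _ _ (begin
      suc P * non a + suc P * # xs (E a)   ≡⟨ trans (sym (*-distribˡ-+ (suc P) (non a) _)) (cong (suc P *_) (trans (+-comm (non a) _) (#+#not xs (E a)))) ⟩
      M + P * M                            ≡⟨ +-comm M (P * M) ⟩
      P * M + M                            ≤⟨ +-monoʳ-≤ (P * M) (dense a) ⟩
      P * M + suc P * # xs (E a)           ∎)
      where open ≤-Reasoning

    -- The weight h records the constraints on the i-th entry imposed by the entries before it.
    isolated-bound : ∀ s (i : Fin (suc s)) (h : A → ℕ) →
      suc P ^ s * ∑ (vecs xs (suc s)) (λ x → h (lookup x i) * 𝟙 (isolated i x)) ≤ (P * M) ^ s * ∑ xs h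
    isolated-bound s zero h = begin
      suc P ^ s * ∑ (vecs xs (suc s)) (λ x → h (lookup x zero) * 𝟙 (isolated zero x))
        ≡⟨ cong (suc P ^ s *_) (trans (∑-vecs-suc xs s _) (∑-cong xs (λ a → trans (∑-*ˡ (vecs xs s) (h a) _) (cong (h a *_) (#-allᵛ xs _ s))))) ⟩
      suc P ^ s * ∑ xs (λ a → h a * non a ^ s)
        ≡⟨ ∑-*ˡ xs (suc P ^ s) _ ⟨
      ∑ xs (λ a → suc P ^ s * (h a * non a ^ s))
        ≤⟨ ∑-mono xs pointwise ⟩
      ∑ xs (λ a → (P * M) ^ s * h a)
        ≡⟨ ∑-*ˡ xs ((P * M) ^ s) h ⟩
      (P * M) ^ s * ∑ xs h ∎
      where
      open ≤-Reasoning
      open +-*-Solver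
      pointwise : ∀ a → suc P ^ s * (h a * non a ^ s) ≤ (P * M) ^ s * h a
      pointwise a = begin
        suc P ^ s * (h a * non a ^ s)    ≡⟨ solve 3 (λ x y z → x :* (y :* z) := x :* z :* y) refl (suc P ^ s) (h a) (non a ^ s) ⟩
        suc P ^ s * non a ^ s * h a      ≡⟨ cong (_* h a) (^-distribʳ-* (suc P) (non a) s) ⟨
        (suc P * non a) ^ s * h a        ≤⟨ *-monoˡ-≤ (h a) (^-monoˡ-≤ s (sparse-complement a)) ⟩
        (P * M) ^ s * h a                ∎
    isolated-bound (suc s) (suc i) h = begin
      suc P * suc P ^ s * ∑ (vecs xs (suc (suc s))) (λ x → h (lookup x (suc i)) * 𝟙 (isolated (suc i) x))
        ≡⟨ cong (suc P * suc P ^ s *_) (trans (∑-vecs-suc xs (suc s) _) (∑-cong xs λ y → ∑-cong (vecs xs (suc s)) (regroup y))) ⟩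
      suc P * suc P ^ s * ∑ xs (λ y → S y)
        ≡⟨ trans (*-assoc (suc P) (suc P ^ s) (∑ xs S)) (cong (suc P *_) (sym (∑-*ˡ xs (suc P ^ s) S))) ⟩
      suc P * ∑ xs (λ y → suc P ^ s * S y)
        ≤⟨ *-monoʳ-≤ (suc P) (∑-mono xs λ y → isolated-bound s i (h′ y)) ⟩
      suc P * ∑ xs (λ y → (P * M) ^ s * ∑ xs (h′ y))
        -- After exchanging the sums, the weights `h′ y a` over all heads y add up to `h a * non a`;
        -- the bound on `non a` then supplies the remaining factor P M / (P + 1).
        ≡⟨ cong (suc P *_) (trans (∑-*ˡ xs ((P * M) ^ s) _) (cong ((P * M) ^ s *_) (trans (∑-swap xs xs h′) (∑-cong xs λ a → ∑-*ˡ xs (h a) _)))) ⟩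
      suc P * ((P * M) ^ s * ∑ xs (λ a → h a * non a))
        ≡⟨ solve 3 (λ x y z → x :* (y :* z) := y :* (x :* z)) refl (suc P) ((P * M) ^ s) _ ⟩
      (P * M) ^ s * (suc P * ∑ xs (λ a → h a * non a))
        ≡⟨ cong ((P * M) ^ s *_) (∑-*ˡ xs (suc P) _) ⟨
      (P * M) ^ s * ∑ xs (λ a → suc P * (h a * non a))
        ≤⟨ *-monoʳ-≤ ((P * M) ^ s) (∑-mono xs λ a → ≤-trans (≤-reflexive (solve 3 (λ x y z → x :* (y :* z) := x :* z :* y) refl (suc P) (h a) (non a))) (*-monoˡ-≤ (h a) (sparse-complement a))) ⟩
      (P * M) ^ s * ∑ xs (λ a → P * M * h a)
        ≡⟨ cong ((P * M) ^ s *_) (∑-*ˡ xs (P * M) h) ⟩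
      (P * M) ^ s * (P * M * ∑ xs h)
        ≡⟨ solve 3 (λ x y z → y :* (x :* z) := x :* y :* z) refl (P * M) ((P * M) ^ s) (∑ xs h) ⟩
      P * M * (P * M) ^ s * ∑ xs h ∎
      where
      open ≤-Reasoning
      open +-*-Solver
      h′ : A → A → ℕ
      h′ y a = h a * 𝟙 (not (E a y))
      S : A → ℕ
      S y = ∑ (vecs xs (suc s)) (λ x → h′ y (lookup x i) * 𝟙 (isolated i x))
      regroup : ∀ y x → h (lookup x i) * 𝟙 (isolated i x ∧ not (E (lookup x i) y)) ≡ h′ y (lookup x i) * 𝟙 (isolated i x)
      regroup y x rewrite 𝟙-∧ (isolated i x) (not (E (lookup x i) y)) =
        solve 3 (λ x y z → x :* (y :* z) := x :* z :* y) refl (h (lookup x i)) (𝟙 (isolated i x)) _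

    -- By `isolated-bound` with constant weight 1, a fixed position is isolated in at most a (P/(P +
    -- 1))^s share of the samples; the hypothesis on s turns this into 1/(2(s + 1)).
    few-isolated : ∀ s → 2 * suc s * P ^ s ≤ suc P ^ s → ∀ i →
      2 * suc s * # (vecs xs (suc s)) (isolated i) ≤ M ^ suc s
    few-isolated s le i = *-cancelˡ-≤ (suc P ^ s) {{m^n≢0 (suc P) s}} (begin
      suc P ^ s * (2 * suc s * N)     ≡⟨ solve 3 (λ x y z → x :* (y :* z) := y :* (x :* z)) refl (suc P ^ s) (2 * suc s) N ⟩
      2 * suc s * (suc P ^ s * N)     ≤⟨ *-monoʳ-≤ (2 * suc s) bound ⟩
      2 * suc s * ((P * M) ^ s * M)   ≡⟨ cong (λ e → 2 * suc s * (e * M)) (^-distribʳ-* P M s) ⟩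
      2 * suc s * (P ^ s * M ^ s * M) ≡⟨ solve 4 (λ x y z w → x :* (y :* z :* w) := x :* y :* (w :* z)) refl (2 * suc s) (P ^ s) (M ^ s) M ⟩
      2 * suc s * P ^ s * M ^ suc s   ≤⟨ *-monoˡ-≤ (M ^ suc s) le ⟩
      suc P ^ s * M ^ suc s           ∎)
      where
      open ≤-Reasoning
      open +-*-Solver
      N = # (vecs xs (suc s)) (isolated i)
      bound : suc P ^ s * N ≤ (P * M) ^ s * M
      bound = subst₂ (λ a b → suc P ^ s * a ≤ (P * M) ^ s * b)
        (∑-cong (vecs xs (suc s)) (λ x → *-identityˡ _)) (sym (length≡∑1 xs)) (isolated-bound s i (λ _ → 1))

  Follows : ∀ {t} → Vec (Fin t) t → Vec A t → Set
  Follows f x = ∀ i → i ≢ lookup f i × E (lookup x i) (lookup x (lookup f i)) ≡ true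

  follows? : ∀ {t} (f : Vec (Fin t) t) x → Dec (Follows f x)
  follows? f x = allᶠ? λ i → ¬? (i ≟ᶠ lookup f i) ×-dec (E (lookup x i) (lookup x (lookup f i)) ≟ᵇ true)

  -- If no entry is isolated, choosing an out-neighbour for each entry defines a map f that the
  -- sample follows. The disjunction is written as an inequality of counts so that it can be summed
  -- over all samples.
  follows-or-isolated : ∀ {t} (x : Vec A t) →
    1 ≤ ∑ (vecs (allFin t) t) (λ f → 𝟙 (does (follows? f x))) + ∑ (allFin t) (λ i → 𝟙 (isolated i x))
  follows-or-isolated {t} x with anyᶠ? (λ i → isolated i x ≟ᵇ true)
  ... | yes (i , iso) = m≤n⇒m≤o+n _ (≤-trans (≤-reflexive (cong 𝟙 (sym iso))) (∈⇒≤∑ (λ i → 𝟙 (isolated i x)) (∈-allFin i)))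
  ... | no ¬iso = m≤n⇒m≤n+o _ (≤-trans (≤-reflexive (cong 𝟙 (sym (dec-true (follows? f x) follows))))
                                      (∈⇒≤∑ (λ f → 𝟙 (does (follows? f x))) (∈-vecs ∈-allFin f)))
    where
    successor : ∀ i → ∃[ j ] i ≢ j × E (lookup x i) (lookup x j) ≡ true
    successor i = not-isolated i x (¬-not λ iso → ¬iso (i , iso))
    f : Vec (Fin t) t
    f = tabulate (proj₁ ∘ successor)
    follows : Follows f x
    follows i rewrite lookup∘tabulate (proj₁ ∘ successor) i = proj₂ (successor i)

  -- By the union bound over the t = s + 1 positions, at most half of the samples have an isolated
  -- entry. The other half is shared among the t^t maps f, so some f is followed by at least a 1/(2
  -- t^t) share.
  popular-successor : ∀ xs P → .{{NonZero (length xs)}} → (∀ a → length xs ≤ suc P * # xs (E a)) →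
    ∀ s → 2 * suc s * P ^ s ≤ suc P ^ s →
    ∃[ f ] length xs ^ suc s ≤ 2 * suc s ^ suc s * # (vecs xs (suc s)) (λ x → does (follows? f x))
  popular-successor xs P dense s le = f , (begin
    M ^ t                      ≤⟨ half ⟩
    2 * ∑ F a                  ≤⟨ *-monoʳ-≤ 2 many ⟩
    2 * (length F * a f)       ≡⟨ cong (λ e → 2 * (e * a f)) (trans (length-vecs (allFin t) t) (cong (_^ t) (length-tabulate {n = t} (λ i → i)))) ⟩
    2 * (t ^ t * a f)          ≡⟨ *-assoc 2 (t ^ t) (a f) ⟨
    2 * t ^ t * a f            ∎)
    where
    open ≤-Reasoning
    t = suc s
    M = length xs
    F = vecs (allFin t) t
    X = vecs xs t
    a : Vec (Fin t) t → ℕ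
    a f = # X (λ x → does (follows? f x))
    b : Fin t → ℕ
    b i = # X (isolated i)
    cover : M ^ t ≤ ∑ F a + ∑ (allFin t) b
    cover = begin
      M ^ t                    ≡⟨ trans (sym (length-vecs xs t)) (length≡∑1 X) ⟩
      ∑ X (λ _ → 1)            ≤⟨ ∑-mono X follows-or-isolated ⟩
      ∑ X (λ x → ∑ F (λ f → 𝟙 (does (follows? f x))) + ∑ (allFin t) (λ i → 𝟙 (isolated i x)))
                               ≡⟨ ∑-+ X _ _ ⟩
      ∑ X (λ x → ∑ F (λ f → 𝟙 (does (follows? f x)))) + ∑ X (λ x → ∑ (allFin t) (λ i → 𝟙 (isolated i x)))
                               ≡⟨ cong₂ _+_ (∑-swap X F _) (∑-swap X (allFin t) _) ⟩
      ∑ F a + ∑ (allFin t) b   ∎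
    isolated-total : 2 * ∑ (allFin t) b ≤ M ^ t
    isolated-total = *-cancelˡ-≤ t (begin
      t * (2 * ∑ (allFin t) b)          ≡⟨ solve 2 (λ t x → t :* (con 2 :* x) := con 2 :* t :* x) refl t (∑ (allFin t) b) ⟩
      2 * t * ∑ (allFin t) b            ≡⟨ ∑-*ˡ (allFin t) (2 * t) b ⟨
      ∑ (allFin t) (λ i → 2 * t * b i)  ≤⟨ ∑-bounded (allFin t) (M ^ t) (few-isolated xs P dense s le) ⟩
      length (allFin t) * M ^ t         ≡⟨ cong (_* M ^ t) (length-tabulate {n = t} (λ i → i)) ⟩
      t * M ^ t                         ∎)
      where open +-*-Solver
    half : M ^ t ≤ 2 * ∑ F a
    half = +-cancelʳ-≤ (M ^ t) _ _ (begin
      M ^ t + M ^ t                           ≤⟨ +-mono-≤ cover cover ⟩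
      (∑ F a + ∑ (allFin t) b) + (∑ F a + ∑ (allFin t) b)
        ≡⟨ solve 2 (λ x y → (x :+ y) :+ (x :+ y) := con 2 :* x :+ con 2 :* y) refl (∑ F a) (∑ (allFin t) b) ⟩
      2 * ∑ F a + 2 * ∑ (allFin t) b          ≤⟨ +-monoʳ-≤ (2 * ∑ F a) isolated-total ⟩
      2 * ∑ F a + M ^ t                       ∎)
      where open +-*-Solver
    positive : 0 < ∑ F a
    positive = *-cancelˡ-< 2 0 (∑ F a) (≤-trans (>-nonZero⁻¹ (M ^ t) {{m^n≢0 M t}}) half)
    popular = pigeonhole F a positive
    f = proj₁ popular
    many = proj₂ (proj₂ popular)

-- Boxes in dense sets

𝟙≤ : ∀ b {m} → (T b → 1 ≤ m) → 𝟙 b ≤ m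
𝟙≤ false _ = z≤n
𝟙≤ true  f = f _

length-allFin : ∀ n → length (allFin n) ≡ n
length-allFin n = length-tabulate {n = n} (λ i → i)

∑-allFin-suc : ∀ n (f : Fin (suc n) → ℕ) → ∑ (allFin (suc n)) f ≡ f zero + ∑ (allFin n) (f ∘ suc)
∑-allFin-suc n f = cong (f zero +_) (trans (cong (λ xs → ∑ xs f) (sym (map-tabulate {n = n} (λ i → i) suc))) (∑-map suc (allFin n) f))

#-≟ : ∀ {n} (u : Fin n) → # (allFin n) (λ v → does (v ≟ᶠ u)) ≡ 1
#-≟ {suc n} zero    = trans (∑-allFin-suc n (λ v → 𝟙 (does (v ≟ᶠ zero)))) (cong suc (trans (∑-const (allFin n) 0) (*-zeroʳ (length (allFin n)))))
#-≟ {suc n} (suc u) = trans (∑-allFin-suc n (λ v → 𝟙 (does (v ≟ᶠ suc u)))) (#-≟ u)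

length-filter≡# : ∀ {P : A → Set} (P? : Decidable P) xs → length (filter P? xs) ≡ # xs (does ∘ P?)
length-filter≡# P? []       = refl
length-filter≡# P? (x ∷ xs) with does (P? x)
... | true  = cong suc (length-filter≡# P? xs)
... | false = length-filter≡# P? xs

length*≤∑ : ∀ {f : A → ℕ} {c xs} → All (λ x → c ≤ f x) xs → length xs * c ≤ ∑ xs f
length*≤∑ []       = z≤n
length*≤∑ (p ∷ ps) = +-mono-≤ p (length*≤∑ ps)

module _ {n : ℕ} where
  open DecMembership (_≟ᶠ_ {n}) using (_∈?_)

  #-∈ : ∀ F → # (allFin n) (λ v → does (v ∈? F)) ≤ length F
  #-∈ F = begin
    # (allFin n) (λ v → does (v ∈? F))                    ≤⟨ ∑-mono (allFin n) pointwise ⟩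
    ∑ (allFin n) (λ v → ∑ F (λ u → 𝟙 (does (v ≟ᶠ u))))     ≡⟨ ∑-swap (allFin n) F _ ⟩
    ∑ F (λ u → # (allFin n) (λ v → does (v ≟ᶠ u)))         ≡⟨ ∑-cong F #-≟ ⟩
    ∑ F (λ _ → 1)                                         ≡⟨ length≡∑1 F ⟨
    length F                                              ∎
    where
    open ≤-Reasoning
    pointwise : ∀ v → 𝟙 (does (v ∈? F)) ≤ ∑ F (λ u → 𝟙 (does (v ≟ᶠ u)))
    pointwise v with v ∈? F
    ... | yes v∈F = ≤-trans (≤-reflexive (cong 𝟙 (sym (dec-true (v ≟ᶠ v) refl)))) (∈⇒≤∑ (λ u → 𝟙 (does (v ≟ᶠ u))) v∈F)
    ... | no _    = z≤n

  select : ∀ (p : Fin n → Bool) F w → w + length F ≤ # (allFin n) p →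
    ∃[ W ] length W ≡ w × Unique W × All (λ v → T (p v) × v ∉ F) W
  select p F w le = take w good
    , trans (length-take w good) (m≤n⇒m⊓n≡m enough)
    , Unique.take⁺ w (Unique.filter⁺ P? (Unique.allFin⁺ n))
    , All.take⁺ w (All.all-filter P? (allFin n))
    where
    open ≤-Reasoning
    P? : Decidable (λ v → T (p v) × v ∉ F)
    P? v = T? (p v) ×-dec ¬? (v ∈? F)
    good = filter P? (allFin n)
    pointwise : ∀ v → 𝟙 (p v) ≤ 𝟙 (does (P? v)) + 𝟙 (does (v ∈? F))
    pointwise v with p v | does (v ∈? F)
    ... | false | _     = z≤n
    ... | true  | true  = ≤-refl
    ... | true  | false = ≤-refl
    enough : w ≤ length good
    enough = +-cancelʳ-≤ (length F) _ _ (begin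
      w + length F                                            ≤⟨ le ⟩
      # (allFin n) p                                          ≤⟨ ∑-mono (allFin n) pointwise ⟩
      ∑ (allFin n) (λ v → 𝟙 (does (P? v)) + 𝟙 (does (v ∈? F))) ≡⟨ ∑-+ (allFin n) _ _ ⟩
      # (allFin n) (does ∘ P?) + # (allFin n) (λ v → does (v ∈? F))
        ≤⟨ +-mono-≤ (≤-reflexive (sym (length-filter≡# P? (allFin n)))) (#-∈ F) ⟩
      length good + length F                                  ∎)

-- Subsequences of prescribed length

combos : ∀ b → List A → List (Vec A b)
combos zero    _        = [] ∷ []
combos (suc b) []       = []
combos (suc b) (x ∷ xs) = map (x ∷_) (combos b xs) ++ combos (suc b) xs

length-combos : ∀ b (xs : List A) → length (combos b xs) ≤ 2 ^ length xs
length-combos zero    xs       = >-nonZero⁻¹ (2 ^ length xs) {{m^n≢0 2 (length xs)}}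
length-combos (suc b) []       = z≤n
length-combos (suc b) (x ∷ xs) = begin
  length (map (x ∷_) (combos b xs) ++ combos (suc b) xs)
    ≡⟨ trans (length-++ (map (x ∷_) (combos b xs))) (cong (_+ length (combos (suc b) xs)) (length-map (x ∷_) (combos b xs))) ⟩
  length (combos b xs) + length (combos (suc b) xs)
    ≤⟨ +-mono-≤ (length-combos b xs) (≤-trans (length-combos (suc b) xs) (m≤m+n _ 0)) ⟩
  2 ^ length (x ∷ xs) ∎
  where open ≤-Reasoning

combos-hit : ∀ (p : A → Bool) b xs → b ≤ # xs p → 1 ≤ ∑ (combos b xs) (𝟙 ∘ allᵛ p)
combos-hit p zero    xs       _  = ≤-refl
combos-hit p (suc b) (x ∷ xs) le
  rewrite ∑-++ (map (x ∷_) (combos b xs)) (combos (suc b) xs) (𝟙 ∘ allᵛ p)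
        | ∑-map (x ∷_) (combos b xs) (𝟙 ∘ allᵛ p)
  with p x
... | true  = m≤n⇒m≤n+o _ (combos-hit p b xs (s≤s⁻¹ le))
... | false = m≤n⇒m≤o+n _ (combos-hit p (suc b) xs le)

combos-All : ∀ {P : A → Set} b {xs} → All P xs → All (λ v → VecAll.All P v) (combos b xs)
combos-All zero    ps       = [] ∷ []
combos-All (suc b) []       = []
combos-All (suc b) (p ∷ ps) = All.++⁺ (All.map⁺ (All.map (p ∷_) (combos-All b ps))) (combos-All (suc b) ps)

combos-Unique : ∀ b {xs : List A} → Unique xs → All VecUnique.Unique (combos b xs)
combos-Unique zero    us       = [] ∷ []
combos-Unique (suc b) []       = []
combos-Unique (suc b) (u ∷ us) = All.++⁺
  (All.map⁺ (All.zipWith (λ { (p , q) → p ∷ q }) (combos-All b u , combos-Unique b us)))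
  (combos-Unique (suc b) us)

allᵛ-lookup : ∀ (p : A → Bool) {m} (v : Vec A m) → allᵛ p v ≡ true → ∀ i → p (lookup v i) ≡ true
allᵛ-lookup p (x ∷ v) eq i with p x in px
allᵛ-lookup p (x ∷ v) eq zero    | true = px
allᵛ-lookup p (x ∷ v) eq (suc i) | true = allᵛ-lookup p v eq i

-- Double counting, with `reverse-Markov` used twice. First, at least n/(2c) vertices are heavy,
-- that is, related to a 1/(2c) share of `xs`; fix w of them outside F. Second, a 1/(4c) share of
-- `xs` is related to at least w/(4c) = b of these w. Each such x is covered by a b-subset of W, and
-- there are at most 2^w of them, so one subset L serves a share of `xs` that is bounded below
-- independently of n.
common-neighbours : ∀ {X : Set} b c .{{_ : NonZero b}} .{{_ : NonZero c}} {n} (F : List (Fin n)) (xs : List X) .{{_ : NonZero (length xs)}}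
  (g : Fin n → X → Bool) → 2 * c * (2 * (2 * c) * b + length F) ≤ n →
  n * length xs ≤ c * ∑ (allFin n) (λ v → # xs (g v)) →
  ∃[ L ] VecUnique.Unique {n = b} L × VecAll.All (_∉ F) L ×
    length xs ≤ 2 * (2 * c) * 2 ^ (2 * (2 * c) * b) * # xs (λ x → allᵛ (λ v → g v x) L)
common-neighbours {X} b c {n} F xs g large dense = L , All.lookup (combos-Unique b W-unique) L∈ , VecAll.map proj₂ (All.lookup (combos-All b W-good) L∈) , (begin
  length xs                        ≤⟨ many-frequent ⟩
  4c * # xs frequent               ≤⟨ *-monoʳ-≤ 4c frequent≤ ⟩
  4c * ∑ (combos b W) G            ≤⟨ *-monoʳ-≤ 4c L-popular ⟩
  4c * (length (combos b W) * G L) ≤⟨ *-monoʳ-≤ 4c (*-monoˡ-≤ (G L) (subst (λ e → length (combos b W) ≤ 2 ^ e) W-length (length-combos b W))) ⟩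
  4c * (2 ^ w * G L)               ≡⟨ *-assoc 4c (2 ^ w) (G L) ⟨
  4c * 2 ^ w * G L                 ∎)
  where
  open ≤-Reasoning
  4c w : ℕ
  4c = 2 * (2 * c)
  w  = 4c * b
  instance
    2c≢0 : NonZero (2 * c)
    2c≢0 = m*n≢0 2 c
    4c≢0 : NonZero 4c
    4c≢0 = m*n≢0 2 (2 * c)
    w≢0 : NonZero w
    w≢0 = m*n≢0 4c b
  degree : Fin n → ℕ
  degree v = # xs (g v)
  heavy : Fin n → Bool
  heavy v = length xs ≤ᵇ 2 * c * degree v
  many-heavy : n ≤ 2 * c * # (allFin n) heavy
  many-heavy = subst (_≤ 2 * c * # (allFin n) heavy) (length-allFin n)
    (reverse-Markov (allFin n) degree (length xs) c (λ v → #≤length xs (g v))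
      (subst (λ e → e * length xs ≤ c * ∑ (allFin n) degree) (sym (length-allFin n)) dense))
  selection = select heavy F w (*-cancelˡ-≤ (2 * c) (≤-trans large many-heavy))
  W = proj₁ selection
  W-length : length W ≡ w
  W-length = proj₁ (proj₂ selection)
  W-unique = proj₁ (proj₂ (proj₂ selection))
  W-good : All (λ v → T (heavy v) × v ∉ F) W
  W-good = proj₂ (proj₂ (proj₂ selection))
  hits : X → ℕ
  hits x = # W (λ v → g v x)
  frequent : X → Bool
  frequent x = w ≤ᵇ 4c * hits x
  many-frequent : length xs ≤ 4c * # xs frequent
  many-frequent = reverse-Markov xs hits w (2 * c)
    (λ x → subst (hits x ≤_) W-length (#≤length W _))
    (begin
      length xs * w                     ≡⟨ trans (*-comm (length xs) w) (cong (_* length xs) (sym W-length)) ⟩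
      length W * length xs              ≤⟨ length*≤∑ (All.map (≤ᵇ⇒≤ (length xs) _ ∘ proj₁) W-good) ⟩
      ∑ W (λ v → 2 * c * degree v)      ≡⟨ ∑-*ˡ W (2 * c) degree ⟩
      2 * c * ∑ W degree                ≡⟨ cong (2 * c *_) (∑-swap W xs _) ⟩
      2 * c * ∑ xs hits                 ∎)
  G : Vec (Fin n) b → ℕ
  G L = # xs (λ x → allᵛ (λ v → g v x) L)
  frequent≤ : # xs frequent ≤ ∑ (combos b W) G
  frequent≤ = begin
    # xs frequent                                                          ≤⟨ ∑-mono xs pointwise ⟩
    ∑ xs (λ x → ∑ (combos b W) (λ L → 𝟙 (allᵛ (λ v → g v x) L)))           ≡⟨ ∑-swap xs (combos b W) _ ⟩
    ∑ (combos b W) G                                                       ∎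
    where
    pointwise : ∀ x → 𝟙 (frequent x) ≤ ∑ (combos b W) (λ L → 𝟙 (allᵛ (λ v → g v x) L))
    pointwise x = 𝟙≤ (frequent x) λ freq → combos-hit (λ v → g v x) b W (*-cancelˡ-≤ 4c (≤ᵇ⇒≤ w _ freq))
  positive : 0 < ∑ (combos b W) G
  positive = *-cancelˡ-< 4c 0 _ (subst (_< 4c * ∑ (combos b W) G) (sym (*-zeroʳ 4c))
    (≤-trans (>-nonZero⁻¹ (length xs)) (≤-trans many-frequent (*-monoʳ-≤ 4c frequent≤))))
  popular = pigeonhole (combos b W) G positive
  L = proj₁ popular
  L∈ = proj₁ (proj₂ popular)
  L-popular = proj₂ (proj₂ popular)

-- A complete m-partite pattern inside `g`: part i consists of the b vertices `B i s`, all parts are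
-- disjoint, and every choice σ of one vertex per part lies in `g`. The list F of vertices to avoid
-- is what keeps the parts disjoint in an induction on m.
Box : ∀ {n} m b → List (Fin n) → (Vec (Fin n) m → Bool) → Set
Box {n} m b F g = Σ[ B ∈ (Fin m → Fin b → Fin n) ]
  (∀ (i : Fin m) (s : Fin b) → B i s ∉ F) ×
  (∀ {i s j s′} → B i s ≡ B j s′ → i ≡ j × s ≡ s′) ×
  (∀ (σ : Fin m → Fin b) → g (tabulate λ i → B i (σ i)) ≡ true)

-- Erdős's theorem on complete multipartite patterns in dense hypergraphs. By `common-neighbours`, b
-- values of the first coordinate have a dense set of common extensions; the induction hypothesis
-- finds the other parts inside that set.
dense⇒Box : ∀ m b c f .{{_ : NonZero b}} .{{_ : NonZero c}} → ∃[ N ] ∀ n → N ≤ n →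
  (F : List (Fin n)) → length F ≤ f → (g : Vec (Fin n) m → Bool) →
  n ^ m ≤ c * # (vecs (allFin n) m) g → Box m b F g
dense⇒Box zero b c f = 0 , λ n _ F _ g dense → (λ ()) , (λ ()) , (λ { {()} }) , λ _ → nonempty g dense
  where
  nonempty : ∀ {n} (g : Vec (Fin n) 0 → Bool) → 1 ≤ c * # (vecs (allFin n) 0) g → g [] ≡ true
  nonempty g le with g []
  ... | true  = refl
  ... | false with () ← subst (1 ≤_) (*-zeroʳ c) le
-- The extra one makes n nonzero, hence the list of m-tuples nonempty.
dense⇒Box (suc m) b c f = suc (N₁ + N₂) , step
  where
  w c′ N₁ N₂ : ℕ
  w  = 2 * (2 * c) * b
  c′ = 2 * (2 * c) * 2 ^ w
  instance
    c′≢0 : NonZero c′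
    c′≢0 = m*n≢0 (2 * (2 * c)) (2 ^ w) {{m*n≢0 2 (2 * c) {{_}} {{m*n≢0 2 c}}}} {{m^n≢0 2 w}}
  -- The later parts must also avoid the b vertices of the first part, and c′ is the density
  -- constant that `common-neighbours` returns.
  rec = dense⇒Box m b c′ (b + f)
  N₁ = 2 * c * (w + f)
  N₂ = proj₁ rec
  step : ∀ n → suc (N₁ + N₂) ≤ n → (F : List (Fin n)) → length F ≤ f → (g : Vec (Fin n) (suc m) → Bool) →
    n ^ suc m ≤ c * # (vecs (allFin n) (suc m)) g → Box (suc m) b F g
  step n n≥ F F≤ g dense = B , avoids , injective , contained
    where
    X = vecs (allFin n) m
    X-length : length X ≡ n ^ m
    X-length = trans (length-vecs (allFin n) m) (cong (_^ m) (length-allFin n))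
    instance
      n≢0 : NonZero n
      n≢0 = >-nonZero (≤-trans (s≤s z≤n) n≥)
      X≢0 : NonZero (length X)
      X≢0 = subst NonZero (sym X-length) (m^n≢0 n m)
    common = common-neighbours b c F X (λ v x → g (v ∷ x))
      (≤-trans (*-monoʳ-≤ (2 * c) (+-monoʳ-≤ w F≤)) (≤-trans (m≤m+n N₁ N₂) (≤-trans (n≤1+n _) n≥)))
      (subst₂ _≤_ (cong (n *_) (sym X-length)) (cong (c *_) (∑-vecs-suc (allFin n) m _)) dense)
    L = proj₁ common
    L-unique = proj₁ (proj₂ common)
    L∉F = proj₁ (proj₂ (proj₂ common))
    g′ : Vec (Fin n) m → Bool
    g′ x = allᵛ (λ v → g (v ∷ x)) L
    rest = proj₂ rec n (≤-trans (m≤n+m N₂ N₁) (≤-trans (n≤1+n _) n≥)) (toList L ++ F)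
      (≤-trans (≤-reflexive (trans (length-++ (toList L)) (cong (_+ length F) (length-toList L)))) (+-monoʳ-≤ b F≤))
      g′ (subst (_≤ c′ * # X g′) X-length (proj₂ (proj₂ (proj₂ common))))
    B′ = proj₁ rest
    B′-avoids = proj₁ (proj₂ rest)
    B′-injective : ∀ {i s j s′} → B′ i s ≡ B′ j s′ → i ≡ j × s ≡ s′
    B′-injective = proj₁ (proj₂ (proj₂ rest))
    B : Fin (suc m) → Fin b → Fin n
    B zero    = lookup L
    B (suc i) = B′ i
    avoids : ∀ i s → B i s ∉ F
    avoids zero    s = VecAll.lookup L∉F (∈-lookup s L)
    avoids (suc i) s = B′-avoids i s ∘ ∈-++⁺ʳ (toList L)
    L-disjoint : ∀ s i s′ → lookup L s ≢ B′ i s′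
    L-disjoint s i s′ eq = B′-avoids i s′ (∈-++⁺ˡ (subst (_∈ toList L) eq (∈-toList⁺ (∈-lookup s L))))
    injective : ∀ {i s j s′} → B i s ≡ B j s′ → i ≡ j × s ≡ s′
    injective {zero}  {s} {zero}  {s′} eq = refl , VecUnique.lookup-injective L-unique s s′ eq
    injective {zero}  {s} {suc j} {s′} eq = contradiction eq (L-disjoint s j s′)
    injective {suc i} {s} {zero}  {s′} eq = contradiction (sym eq) (L-disjoint s′ i s)
    injective {suc i} {s} {suc j} {s′} eq = map₁ (cong suc) (B′-injective eq)
    contained : ∀ σ → g (tabulate λ i → B i (σ i)) ≡ true
    contained σ = allᵛ-lookup (λ v → g (v ∷ _)) L (proj₂ (proj₂ (proj₂ rest)) (σ ∘ suc)) (σ zero)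

-- The upper bound

-- Weight 1 gives the cardinality and weight `toℕ` the sum of the vertices, so one insertion lemma
-- serves both.
wt : (Fin n → ℕ) → Subset n → ℕ
wt f []      = 0
wt f (s ∷ S) = (if s then f zero else 0) + wt (f ∘ suc) S

∣∣≡wt : (S : Subset n) → ∣ S ∣ ≡ wt (λ _ → 1) S
∣∣≡wt []            = refl
∣∣≡wt (inside ∷ S)  = cong suc (∣∣≡wt S)
∣∣≡wt (outside ∷ S) = ∣∣≡wt S

wt-insert : ∀ (f : Fin n → ℕ) v S → v ∉ˢ S → wt f (⁅ v ⁆ ∪ S) ≡ f v + wt f S
wt-insert f zero    (inside ∷ S)  v∉ = contradiction Vec.here v∉
wt-insert f zero    (outside ∷ S) v∉ rewrite ∪-identityˡ S = refl
wt-insert f (suc v) (s ∷ S)       v∉ rewrite wt-insert (f ∘ suc) v S (v∉ ∘ Vec.there) =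
  solve 3 (λ a b c → a :+ (b :+ c) := b :+ (a :+ c)) refl (if s then f zero else 0) (f (suc v)) (wt (f ∘ suc) S)
  where open +-*-Solver

∣insert∣ : ∀ (v : Fin n) S → v ∉ˢ S → ∣ ⁅ v ⁆ ∪ S ∣ ≡ suc ∣ S ∣
∣insert∣ v S v∉ rewrite ∣∣≡wt (⁅ v ⁆ ∪ S) | ∣∣≡wt S = wt-insert (λ _ → 1) v S v∉

∈-toSubset⁻ : ∀ {x : Fin n} xs → x ∈ˢ toSubset xs → x ∈ xs
∈-toSubset⁻ []       x∈ = contradiction x∈ ∉⊥
∈-toSubset⁻ (y ∷ xs) x∈ with x∈p∪q⁻ ⁅ y ⁆ (toSubset xs) x∈
... | inj₁ x∈y  = here (x∈⁅y⁆⇒x≡y y x∈y)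
... | inj₂ x∈xs = there (∈-toSubset⁻ xs x∈xs)

wt-⊥ : ∀ (f : Fin n → ℕ) → wt f ⊥ ≡ 0
wt-⊥ {zero}  f = refl
wt-⊥ {suc n} f = wt-⊥ (f ∘ suc)

wt-toSubset : ∀ (f : Fin n → ℕ) {xs} → Unique xs → wt f (toSubset xs) ≡ ∑ xs f
wt-toSubset f []                 = wt-⊥ f
wt-toSubset f {x ∷ xs} (x∉ ∷ us) =
  trans (wt-insert f x (toSubset xs) (λ x∈ → All.lookup x∉ (∈-toSubset⁻ xs x∈) refl)) (cong (f x +_) (wt-toSubset f us))

∣toSubset∣ : ∀ {xs : List (Fin n)} → Unique xs → ∣ toSubset xs ∣ ≡ length xs
∣toSubset∣ {xs = xs} us = trans (∣∣≡wt (toSubset xs)) (trans (wt-toSubset (λ _ → 1) us) (sym (length≡∑1 xs)))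

toℕ-next : ∀ {m} (i : Fin (suc m)) → toℕ (next i) ≡ suc (toℕ i) % suc m
toℕ-next {m} i = toℕ-fromℕ< (m%n<n (suc (toℕ i)) (suc m))

-- Iterates and periodic points

fold-periodic : ∀ (f : A → A) z c → fold z f c ≡ z → ∀ k → fold z f (k * c) ≡ z
fold-periodic f z c eq zero    = refl
fold-periodic f z c eq (suc k) = trans (fold-+ z f c) (trans (cong (λ y → fold y f c) (fold-periodic f z c eq k)) eq)

fold-% : ∀ (f : A → A) z ℓ .{{_ : NonZero ℓ}} → fold z f ℓ ≡ z → ∀ s → fold z f (s % ℓ) ≡ fold z f s
fold-% f z ℓ eq s = sym (begin
  fold z f s                                       ≡⟨ cong (fold z f) (m≡m%n+[m/n]*n s ℓ) ⟩
  fold z f (s % ℓ + s / ℓ * ℓ)                     ≡⟨ fold-+ z f (s % ℓ) ⟩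
  fold (fold z f (s / ℓ * ℓ)) f (s % ℓ)            ≡⟨ cong (λ y → fold y f (s % ℓ)) (fold-periodic f z ℓ eq (s / ℓ)) ⟩
  fold z f (s % ℓ)                                 ∎)
  where open ≡-Reasoning

m∣m! : ∀ m .{{_ : NonZero m}} → m ∣ m !
m∣m! (suc m) = m∣m*n (m !)

-- Two of the iterates number 0 to t of `zero` coincide, and the difference of their indices is a
-- period c ≤ t of the point reached. Since c divides t!, one value of ℓ suits every map f, so ℓ can
-- be fixed before f is known.
periodic-point : ∀ {s} (f : Fin (suc s) → Fin (suc s)) → ∃[ z ] ∀ ℓ → (suc s) ! ∣ ℓ → fold z f ℓ ≡ z
periodic-point {s} f = from-collision (pigeonholeᶠ (n<1+n (suc s)) (λ i → fold zero f (toℕ i)))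
  where
  t = suc s
  from-collision : (∃[ i ] ∃[ j ] toℕ {suc t} i < toℕ {suc t} j × fold zero f (toℕ i) ≡ fold zero f (toℕ j)) → ∃[ z ] ∀ ℓ → t ! ∣ ℓ → fold z f ℓ ≡ z
  from-collision (i , j , i<j , eq) = fold zero f (toℕ i) , returns
    where
    c = toℕ j ∸ toℕ i
    c≤t : c ≤ t
    c≤t = ≤-trans (m∸n≤m (toℕ j) (toℕ i)) (s≤s⁻¹ (toℕ<n j))
    period : fold (fold zero f (toℕ i)) f c ≡ fold zero f (toℕ i)
    period = trans (sym (fold-+ zero f c)) (trans (cong (fold zero f) (m∸n+n≡m (<⇒≤ i<j))) (sym eq))
    returns : ∀ ℓ → t ! ∣ ℓ → fold (fold zero f (toℕ i)) f ℓ ≡ fold zero f (toℕ i)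
    returns ℓ t!∣ℓ with divides k refl ← ∣-trans (m∣m! c {{>-nonZero (m<n⇒0<n∸m i<j)}}) (∣-trans (m≤n⇒m!∣n! c≤t) t!∣ℓ) =
      fold-periodic f _ c period k

-- Flat tuples and tuples of tuples

chunks : ∀ t r → Vec A (t * r) → Vec (Vec A r) t
chunks t r x = tabulate (λ i → tabulate (λ j → lookup x (combine i j)))

chunks-++ : ∀ t r (u : Vec A r) y → chunks (suc t) r (u ++ᵛ y) ≡ u ∷ chunks t r y
chunks-++ t r u y = cong₂ _∷_
  (trans (tabulate-cong (lookup-++ˡ u y)) (tabulate∘lookup u))
  (tabulate-cong λ i → tabulate-cong λ j → lookup-++ʳ u y (combine i j))

∑-vecs-++ : ∀ (xs : List A) m k f →
  ∑ (vecs xs (m + k)) f ≡ ∑ (vecs xs m) (λ u → ∑ (vecs xs k) (λ y → f (u ++ᵛ y)))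
∑-vecs-++ xs zero    k f = sym (+-identityʳ _)
∑-vecs-++ xs (suc m) k f = begin
  ∑ (vecs xs (suc m + k)) f
    ≡⟨ ∑-vecs-suc xs (m + k) f ⟩
  ∑ xs (λ a → ∑ (vecs xs (m + k)) (λ x → f (a ∷ x)))
    ≡⟨ ∑-cong xs (λ a → ∑-vecs-++ xs m k (λ x → f (a ∷ x))) ⟩
  ∑ xs (λ a → ∑ (vecs xs m) (λ u → ∑ (vecs xs k) (λ y → f (a ∷ u ++ᵛ y))))
    ≡⟨ ∑-vecs-suc xs m (λ u → ∑ (vecs xs k) (λ y → f (u ++ᵛ y))) ⟨
  ∑ (vecs xs (suc m)) (λ u → ∑ (vecs xs k) (λ y → f (u ++ᵛ y))) ∎
  where open ≡-Reasoning

-- Cutting a flat tuple into t pieces of length r is a bijection, so a density among samples of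
-- r-tuples becomes a density among flat tuples of vertices, to which `dense⇒Box` applies.
∑-chunks : ∀ (xs : List A) t r f → ∑ (vecs xs (t * r)) (f ∘ chunks t r) ≡ ∑ (vecs (vecs xs r) t) f
∑-chunks xs zero    r f = refl
∑-chunks xs (suc t) r f = begin
  ∑ (vecs xs (r + t * r)) (f ∘ chunks (suc t) r)
    ≡⟨ ∑-vecs-++ xs r (t * r) _ ⟩
  ∑ (vecs xs r) (λ u → ∑ (vecs xs (t * r)) (λ y → f (chunks (suc t) r (u ++ᵛ y))))
    ≡⟨ ∑-cong (vecs xs r) (λ u → trans (∑-cong (vecs xs (t * r)) (λ y → cong f (chunks-++ t r u y))) (∑-chunks xs t r (λ x → f (u ∷ x)))) ⟩
  ∑ (vecs xs r) (λ u → ∑ (vecs (vecs xs r) t) (λ x → f (u ∷ x)))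
    ≡⟨ ∑-vecs-suc (vecs xs r) t f ⟨
  ∑ (vecs (vecs xs r) (suc t)) f ∎
  where open ≡-Reasoning

does-true : ∀ {P : Set} (P? : Dec P) → does P? ≡ true → P
does-true (yes p) _ = p

module _ {r n : ℕ} (H : KGraph (suc r) n) where

  tupleSet : Vec (Fin n) r → Subset n
  tupleSet u = toSubset (map (lookup u) (allFin r))

  -- Degenerate tuples (those with a repeated vertex) are joined to everything, so that every tuple has many neighbours.
  joined : Vec (Fin n) r → Fin n → Bool
  joined u v = edge H (⁅ v ⁆ ∪ tupleSet u) ∨ not (does (∣ tupleSet u ∣ ≟ r))

  arc : Vec (Fin n) r → Vec (Fin n) r → Bool
  arc u w = allᵛ (joined u) w

  joined-proper : ∀ u v → ∣ tupleSet u ∣ ≡ r → joined u v ≡ edge H (⁅ v ⁆ ∪ tupleSet u)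
  joined-proper u v size rewrite dec-true (∣ tupleSet u ∣ ≟ r) size = ∨-identityʳ _

  joined-degenerate : ∀ u v → ∣ tupleSet u ∣ ≢ r → joined u v ≡ true
  joined-degenerate u v size rewrite dec-false (∣ tupleSet u ∣ ≟ r) size = ∨-zeroʳ _

  joined-dense : ∀ {q D} .{{_ : NonZero q}} → δ≥ H D → n ≤ q * D → ∀ u → n ≤ q * # (allFin n) (joined u)
  joined-dense {q} {D} δ n≤qD u with ∣ tupleSet u ∣ ≟ r
  ... | yes size = ≤-trans n≤qD (*-monoʳ-≤ q (≤-trans (δ (tupleSet u) size)
          (≤-reflexive (∑-cong (allFin n) λ v → cong 𝟙 (sym (joined-proper u v size))))))
  ... | no size = ≤-trans (≤-reflexive (trans (sym (length-allFin n)) (trans (length≡∑1 (allFin n))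
          (∑-cong (allFin n) λ v → cong 𝟙 (sym (joined-degenerate u v size)))))) (m≤n*m _ q)

  -- An arc from u imposes r independent conditions on the entries of its target, each of density at
  -- least 1/q.
  arc-dense : ∀ {q D} .{{_ : NonZero q}} → δ≥ H D → n ≤ q * D →
    ∀ u → length (vecs (allFin n) r) ≤ q ^ r * # (vecs (allFin n) r) (arc u)
  arc-dense {q} δ n≤qD u = begin
    length (vecs (allFin n) r)                  ≡⟨ trans (length-vecs (allFin n) r) (cong (_^ r) (length-allFin n)) ⟩
    n ^ r                                       ≤⟨ ^-monoˡ-≤ r (joined-dense δ n≤qD u) ⟩
    (q * # (allFin n) (joined u)) ^ r           ≡⟨ ^-distribʳ-* q _ r ⟩
    q ^ r * # (allFin n) (joined u) ^ r         ≡⟨ cong (q ^ r *_) (#-allᵛ (allFin n) (joined u) r) ⟨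
    q ^ r * # (vecs (allFin n) r) (arc u)       ∎
    where open ≤-Reasoning

  open Sampling arc

  Box⇒zycle : ∀ {s} m (f : Vec (Fin (suc s)) (suc s)) → (suc s) ! ∣ suc m →
    Box (suc s * r) (suc m) [] (λ x → does (follows? f (chunks (suc s) r x))) → ContainsZycle (suc m) H
  Box⇒zycle {s} m f t!∣ℓ (B , _ , B-injective , B-good) = φ , φ-injective , φ-edge
    where
    t ℓ : ℕ
    t = suc s
    ℓ = suc m
    z : Fin t
    z = proj₁ (periodic-point (lookup f))
    p : Fin ℓ → Fin t
    p i = fold z (lookup f) (toℕ i)
    -- At the last index this is the return of the walk to z after ℓ steps, which holds because t!
    -- divides ℓ.
    p-next : ∀ i → p (next i) ≡ lookup f (p i)
    p-next i = trans (cong (fold z (lookup f)) (toℕ-next i))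
      (fold-% (lookup f) z ℓ (proj₂ (periodic-point (lookup f)) ℓ t!∣ℓ) (suc (toℕ i)))
    φ : ZVertex (suc r) ℓ → Fin n
    φ (i , j) = B (combine (p i) j) i
    φ-injective : Injective _≡_ _≡_ φ
    φ-injective {i , j} {i′ , j′} eq with B-injective eq
    ... | c≡ , refl = cong (i ,_) (proj₂ (combine-injective (p i) j (p i) j′ c≡))
    row : Fin ℓ → Vec (Fin n) r
    row i = tabulate (λ j → φ (i , j))
    -- Rows consist of r distinct vertices, so `joined` takes no degenerate branch on them and arcs
    -- yield genuine edges.
    row-size : ∀ i → ∣ tupleSet (row i) ∣ ≡ r
    row-size i = trans (cong (∣_∣ ∘ toSubset) (map-cong (lookup∘tabulate _) (allFin r)))
      (trans (∣toSubset∣ (Unique.map⁺ (λ eq → φ-second (φ-injective eq)) (Unique.allFin⁺ r)))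
        (trans (length-map (λ j → φ (i , j)) (allFin r)) (length-allFin r)))
      where
      φ-second : ∀ {j j′ : Fin r} → (i , j) ≡ (i , j′) → j ≡ j′
      φ-second refl = refl
    rows-joined : ∀ i → arc (row i) (row (next i)) ≡ true
    rows-joined i = subst₂ (λ u w → arc u w ≡ true) at-p at-p-next (proj₂ step)
      where
      -- Layer i on the parts of `p i`, layer `next i` everywhere else. As f has no fixed point, the
      -- parts of `p (next i)` are among the latter, so a single choice from the box contains both
      -- consecutive rows.
      σ : Fin (t * r) → Fin ℓ
      σ c = if does (proj₁ (remQuot {t} r c) ≟ᶠ p i) then i else next i
      x = chunks t r (tabulate (λ c → B c (σ c)))
      step : p i ≢ p (next i) × arc (lookup x (p i)) (lookup x (p (next i))) ≡ true
      step = subst (λ a → p i ≢ a × arc (lookup x (p i)) (lookup x a) ≡ true) (sym (p-next i))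
        (does-true (follows? f x) (B-good σ) (p i))
      lookup-x : ∀ a → lookup x a ≡ tabulate (λ j → B (combine a j) (σ (combine a j)))
      lookup-x a = trans
        (lookup∘tabulate (λ a → tabulate (λ j → lookup (tabulate (λ c → B c (σ c))) (combine a j))) a)
        (tabulate-cong λ j → lookup∘tabulate (λ c → B c (σ c)) (combine a j))
      σ-combine : ∀ a j → σ (combine a j) ≡ (if does (a ≟ᶠ p i) then i else next i)
      σ-combine a j = cong (λ e → if does (proj₁ e ≟ᶠ p i) then i else next i) (remQuot-combine {t} {r} a j)
      at-p : lookup x (p i) ≡ row i
      at-p = trans (lookup-x (p i)) (tabulate-cong λ j → cong (B (combine (p i) j))
        (trans (σ-combine (p i) j) (cong (if_then i else next i) (dec-true (p i ≟ᶠ p i) refl))))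
      at-p-next : lookup x (p (next i)) ≡ row (next i)
      at-p-next = trans (lookup-x (p (next i))) (tabulate-cong λ j → cong (B (combine (p (next i)) j))
        (trans (σ-combine (p (next i)) j) (cong (if_then i else next i) (dec-false (p (next i) ≟ᶠ p i) (proj₁ step ∘ sym)))))
    φ-edge : ∀ i j → edge H (toSubset (map φ (zycleEdge {suc r} {ℓ} i j))) ≡ true
    φ-edge i j = subst₂ (λ v xs → edge H (⁅ v ⁆ ∪ toSubset xs) ≡ true)
      (lookup∘tabulate _ j)
      (trans (map-cong (lookup∘tabulate _) (allFin r)) (map-∘ (allFin r)))
      (trans (sym (joined-proper (row i) _ (row-size i))) (allᵛ-lookup (joined (row i)) (row (next i)) (rows-joined i) j))

-- The sample size t comes from q^r alone, before ℓ and n are chosen; the threshold N also depends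
-- on ℓ, since the box needs parts of size ℓ.
dense⇒zycle : ∀ r q .{{_ : NonZero r}} → 2 ≤ q →
  ∃[ t ] 1 ≤ t × ∀ m → t ! ∣ suc m →
  ∃[ N ] ∀ n → N ≤ n → (H : KGraph (suc r) n) → ∀ D → δ≥ H D → n ≤ q * D → ContainsZycle (suc m) H
dense⇒zycle r q 2≤q = t , s≤s z≤n , λ m t!∣ℓ → suc (N m) , λ n n≥ H D δ n≤qD → zycle m t!∣ℓ n n≥ H D δ n≤qD
  where
  -- Out-degrees have density 1/q^r = 1/(P + 1), and 2 ≤ q makes P nonzero, as `sample-size`
  -- requires.
  P : ℕ
  P = pred (q ^ r)
  instance
    q≢0 : NonZero q
    q≢0 = >-nonZero (≤-trans (s≤s z≤n) 2≤q)
    q^r≢0 : NonZero (q ^ r)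
    q^r≢0 = m^n≢0 q r
    P≢0 : NonZero P
    P≢0 = >-nonZero (s≤s⁻¹ (≤-trans (≤-trans 2≤q (≤-trans (≤-reflexive (sym (*-identityʳ q))) (^-monoʳ-≤ q (>-nonZero⁻¹ r))))
      (≤-reflexive (sym (suc-pred (q ^ r))))))
  s t : ℕ
  s = proj₁ (sample-size P)
  t = suc s
  c : ℕ
  c = 2 * t ^ t
  instance
    c≢0 : NonZero c
    c≢0 = m*n≢0 2 (t ^ t) {{_}} {{m^n≢0 t t}}
  N : ℕ → ℕ
  N m = proj₁ (dense⇒Box (t * r) (suc m) c 0)
  zycle : ∀ m → t ! ∣ suc m → ∀ n → suc (N m) ≤ n → (H : KGraph (suc r) n) → ∀ D → δ≥ H D → n ≤ q * D → ContainsZycle (suc m) H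
  zycle m t!∣ℓ n n≥ H D δ n≤qD = Box⇒zycle H m f t!∣ℓ
    (proj₂ (dense⇒Box (t * r) (suc m) c 0) n (≤-trans (n≤1+n _) n≥) [] z≤n (λ x → does (follows? f (chunks t r x))) (begin
      n ^ (t * r)                  ≡⟨ trans (cong (n ^_) (*-comm t r)) (sym (^-*-assoc n r t)) ⟩
      (n ^ r) ^ t                  ≡⟨ cong (_^ t) V-length ⟨
      length V ^ t                 ≤⟨ proj₂ popular ⟩
      c * # (vecs V t) (λ x → does (follows? f x))
                                   ≡⟨ cong (c *_) (∑-chunks (allFin n) t r (λ x → 𝟙 (does (follows? f x)))) ⟨
      c * # (vecs (allFin n) (t * r)) (λ x → does (follows? f (chunks t r x))) ∎))
    where
    open ≤-Reasoning
    open Sampling (arc H)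
    V = vecs (allFin n) r
    V-length : length V ≡ n ^ r
    V-length = trans (length-vecs (allFin n) r) (cong (_^ r) (length-allFin n))
    instance
      V≢0 : NonZero (length V)
      V≢0 = subst NonZero (sym V-length) (m^n≢0 n r {{>-nonZero (≤-trans (s≤s z≤n) n≥)}})
    popular = popular-successor V P
      (λ u → subst (λ e → length V ≤ e * # V (arc H u)) (sym (suc-pred (q ^ r))) (arc-dense H δ n≤qD u))
      s (proj₂ (sample-size P))
    f = proj₁ popular

-- The lower bound

cnt : (ℕ → Bool) → ℕ → ℕ
cnt p zero    = 0
cnt p (suc n) = 𝟙 (p 0) + cnt (p ∘ suc) n

#-toℕ : ∀ p n → # (allFin n) (p ∘ toℕ) ≡ cnt p n
#-toℕ p zero    = refl
#-toℕ p (suc n) = trans (∑-allFin-suc n (λ v → 𝟙 (p (toℕ v)))) (cong (𝟙 (p 0) +_) (#-toℕ (p ∘ suc) n))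

cnt-+ : ∀ p m n → cnt p (m + n) ≡ cnt p m + cnt (p ∘ (m +_)) n
cnt-+ p zero    n = refl
cnt-+ p (suc m) n = trans (cong (𝟙 (p 0) +_) (cnt-+ (p ∘ suc) m n)) (sym (+-assoc (𝟙 (p 0)) _ _))

cnt-hit : ∀ p {c n} → c < n → p c ≡ true → 1 ≤ cnt p n
cnt-hit p {zero}  {suc n} _         pc rewrite pc = s≤s z≤n
cnt-hit p {suc c} {suc n} (s≤s c<n) pc = m≤n⇒m≤o+n _ (cnt-hit (p ∘ suc) c<n pc)

-- One hit in each of K consecutive blocks. The hypothesis speaks of every offset a so that it
-- survives the shift to the next block.
cnt-blocks : ∀ p M → (∀ a → ∃[ c ] c < M × p (a + c) ≡ true) → ∀ K {n} → K * M ≤ n → K ≤ cnt p n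
cnt-blocks p M hits zero    _  = z≤n
cnt-blocks p M hits (suc K) {n} le = begin
  1 + K                                               ≤⟨ +-mono-≤ (cnt-hit p (proj₁ (proj₂ (hits 0))) (proj₂ (proj₂ (hits 0))))
                                                            (cnt-blocks (p ∘ (M +_)) M shifted K (m+n≤o⇒m≤o∸n (K * M) (≤-trans (≤-reflexive (+-comm (K * M) M)) le))) ⟩
  cnt p M + cnt (p ∘ (M +_)) (n ∸ M)                  ≡⟨ cnt-+ p M (n ∸ M) ⟨
  cnt p (M + (n ∸ M))                                 ≡⟨ cong (cnt p) (m+[n∸m]≡n (≤-trans (m≤m+n M _) le)) ⟩
  cnt p n                                             ∎
  where
  open ≤-Reasoning
  shifted : ∀ a → ∃[ c ] c < M × p (M + (a + c)) ≡ true
  shifted a with c , c<M , pc ← hits (M + a) = c , c<M , trans (cong p (sym (+-assoc M a c))) pc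

-- Raising a by one lowers c by one, and below 0 it wraps around to M - 1.
complement-residue : ∀ M .{{_ : NonZero M}} a → ∃[ c ] c < M × M ∣ c + a
complement-residue M         zero    = 0 , >-nonZero⁻¹ M , (M ∣0)
complement-residue M@(suc M′) (suc a) with complement-residue M a
... | suc c , c<M , M∣ = c , <-trans (n<1+n c) c<M , subst (M ∣_) (sym (+-suc c a)) M∣
... | zero  , _   , M∣ = M′ , n<1+n M′ , subst (M ∣_) (sym (+-suc M′ a)) (∣m∣n⇒∣m+n ∣-refl M∣)

#-lookup : (S : Subset n) → # (allFin n) (lookup S) ≡ ∣ S ∣
#-lookup []            = refl
#-lookup {suc n} (inside ∷ S)  = trans (∑-allFin-suc n (𝟙 ∘ lookup (inside ∷ S))) (cong suc (#-lookup S))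
#-lookup {suc n} (outside ∷ S) = trans (∑-allFin-suc n (𝟙 ∘ lookup (outside ∷ S))) (#-lookup S)

∣-∑ : ∀ {M} (xs : List A) f → (∀ x → M ∣ f x) → M ∣ ∑ xs f
∣-∑ []       f M∣ = _ ∣0
∣-∑ (x ∷ xs) f M∣ = ∣m∣n⇒∣m+n (M∣ x) (∣-∑ xs f M∣)

∧-trueˡ : ∀ {a b} → a ∧ b ≡ true → a ≡ true
∧-trueˡ {true} _ = refl

∧-trueʳ : ∀ {a b} → a ∧ b ≡ true → b ≡ true
∧-trueʳ {true} eq = eq

next≢ : ∀ {m} (i : Fin (suc (suc m))) → next i ≢ i
next≢ {m} i eq with suc (toℕ i) <? suc (suc m)
... | yes lt = 1+n≢n (trans (sym (m<n⇒m%n≡m lt)) (trans (sym (toℕ-next i)) (cong toℕ eq)))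
... | no ¬lt = contradiction (trans (sym i+1≡) (cong suc i≡0)) λ ()
  where
  i+1≡ : suc (toℕ i) ≡ suc (suc m)
  i+1≡ = ≤-antisym (toℕ<n i) (≮⇒≥ ¬lt)
  i≡0 : toℕ i ≡ 0
  i≡0 = trans (sym (cong toℕ eq)) (trans (toℕ-next i) (trans (cong (_% suc (suc m)) i+1≡) (n%n≡0 (suc (suc m)))))

module _ (r M n : ℕ) .{{M≢0 : NonZero M}} where

  -- The sum of the vertices of an edge is ≡ 1 modulo M, with M − 1 added to avoid subtraction.
  sumGraph : KGraph (suc r) n
  sumGraph .edge e = does (∣ e ∣ ≟ suc r) ∧ does (M ∣? wt toℕ e + pred M)
  sumGraph .uniform e eq = does-true (∣ e ∣ ≟ suc r) (∧-trueˡ eq)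

  sumGraph-edge : ∀ e → ∣ e ∣ ≡ suc r → M ∣ wt toℕ e + pred M → edge sumGraph e ≡ true
  sumGraph-edge e size M∣ = cong₂ _∧_ (dec-true (∣ e ∣ ≟ suc r) size) (dec-true (M ∣? wt toℕ e + pred M) M∣)

  -- Among any M consecutive integers one brings the sum of S to the right residue, which gives at
  -- least n / M candidates; at most r of them lie in S itself and are lost.
  sumGraph-δ : δ≥ sumGraph (n / M ∸ r)
  sumGraph-δ S size = m≤n+o⇒m∸n≤o (n / M) r (begin
    n / M                                        ≤⟨ cnt-blocks p M p-hits (n / M) (m/n*n≤m n M) ⟩
    cnt p n                                      ≡⟨ #-toℕ p n ⟨
    # (allFin n) (p ∘ toℕ)                       ≤⟨ ∑-mono (allFin n) pointwise ⟩
    ∑ (allFin n) (λ v → 𝟙 (lookup S v) + 𝟙 (edge sumGraph (⁅ v ⁆ ∪ S)))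
                                                 ≡⟨ ∑-+ (allFin n) _ _ ⟩
    # (allFin n) (lookup S) + codeg sumGraph S   ≡⟨ cong (_+ codeg sumGraph S) (trans (#-lookup S) size) ⟩
    r + codeg sumGraph S                         ∎)
    where
    open ≤-Reasoning
    a : ℕ
    a = wt toℕ S + pred M
    p : ℕ → Bool
    p v = does (M ∣? v + a)
    p-hits : ∀ b → ∃[ c ] c < M × p (b + c) ≡ true
    p-hits b with c , c<M , M∣ ← complement-residue M (b + a) =
      c , c<M , dec-true (M ∣? b + c + a) (subst (M ∣_) (solve 3 (λ a b c → c :+ (b :+ a) := b :+ c :+ a) refl a b c) M∣)
      where open +-*-Solver
    extends : ∀ v → v ∉ˢ S → M ∣ toℕ v + a → edge sumGraph (⁅ v ⁆ ∪ S) ≡ true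
    extends v v∉ M∣ = sumGraph-edge (⁅ v ⁆ ∪ S) (trans (∣insert∣ v S v∉) (cong suc size))
      (subst (M ∣_) (trans (sym (+-assoc (toℕ v) _ _)) (cong (_+ pred M) (sym (wt-insert toℕ v S v∉)))) M∣)
    pointwise : ∀ v → 𝟙 (p (toℕ v)) ≤ 𝟙 (lookup S v) + 𝟙 (edge sumGraph (⁅ v ⁆ ∪ S))
    pointwise v = go (lookup S v) refl (M ∣? toℕ v + a)
      where
      go : ∀ b → lookup S v ≡ b → (d : Dec (M ∣ toℕ v + a)) → 𝟙 (does d) ≤ 𝟙 b + 𝟙 (edge sumGraph (⁅ v ⁆ ∪ S))
      go _     _  (no _)   = z≤n
      go true  _  (yes _)  = s≤s z≤n
      go false eq (yes M∣) = ≤-reflexive (cong 𝟙 (sym (extends v (λ v∈ → contradiction (trans (sym eq) ([]=⇒lookup v∈)) λ ()) M∣)))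

  -- The sum of the congruences of the r edges through row i: each edge contributes one vertex of
  -- the next row and the whole of row i. Since `pred M` stands for -1, this reads a′ ≡ r - r a
  -- modulo M.
  sumGraph-zycle : ∀ {m} (Z : ContainsZycle (suc (suc m)) sumGraph) (let φ = proj₁ Z) (i : Fin (suc (suc m))) →
    let rowSum = λ i → ∑ (allFin r) (λ j → toℕ (φ (i , j))) in
    M ∣ rowSum (next i) + r * (rowSum i + pred M)
  sumGraph-zycle {m} (φ , φ-injective , φ-edge) i = subst (M ∣_)
    (trans (∑-+ (allFin r) _ _) (cong (rowSum (next i) +_)
      (trans (∑-const (allFin r) _) (cong (_* (rowSum i + pred M)) (length-allFin r)))))
    (∣-∑ (allFin r) _ edge-sum)
    where
    rowSum : Fin (suc (suc m)) → ℕ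
    rowSum i = ∑ (allFin r) (λ j → toℕ (φ (i , j)))
    E : Fin r → List (ZVertex (suc r) (suc (suc m)))
    E j = zycleEdge {suc r} i j
    -- Only for a list without repetition is the weight of its set the sum over the list; the vertex
    -- of the next row is new because ℓ is at least 2.
    E-unique : ∀ j → Unique (E j)
    E-unique j = All.map⁺ (All.universal (λ t eq → next≢ i (cong proj₁ eq)) (allFin r))
               ∷ Unique.map⁺ (λ { refl → refl }) (Unique.allFin⁺ r)
    E-sum : ∀ j → wt toℕ (toSubset (map φ (E j))) ≡ toℕ (φ (next i , j)) + rowSum i
    E-sum j = trans (wt-toSubset toℕ (Unique.map⁺ φ-injective (E-unique j)))
      (cong (toℕ (φ (next i , j)) +_) (trans (∑-map φ (map (i ,_) (allFin r)) toℕ) (∑-map (i ,_) (allFin r) (toℕ ∘ φ))))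
    edge-sum : ∀ j → M ∣ toℕ (φ (next i , j)) + (rowSum i + pred M)
    edge-sum j = subst (M ∣_) (trans (cong (_+ pred M) (E-sum j)) (+-assoc (toℕ (φ (next i , j))) _ _))
      (does-true (M ∣? wt toℕ (toSubset (map φ (E j))) + pred M) (∧-trueʳ (φ-edge i j)))

-- The map a ↦ r - r a has fixed point r/k with k = r + 1. Measuring from it and clearing the
-- denominator gives c = k a - r with c′ ≡ - r c, and the factor k raises the modulus from M to k M.
affine-step : ∀ r μ q a a′ → a′ + r * (a + μ) ≡ q * suc μ →
  ⁺ (suc r * suc μ) ℤ.∣ (⁺ suc r ℤ.* ⁺ a′ ℤ.- ⁺ r) ℤ.+ ⁺ r ℤ.* (⁺ suc r ℤ.* ⁺ a ℤ.- ⁺ r)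
affine-step r μ q a a′ eq = ℤ.divides (⁺ q ℤ.- ⁺ r) (begin
  (⁺ suc r ℤ.* ⁺ a′ ℤ.- ⁺ r) ℤ.+ ⁺ r ℤ.* (⁺ suc r ℤ.* ⁺ a ℤ.- ⁺ r)
    ≡⟨ solve 4 (λ r μ a b → ((con (⁺ 1) :+ r) :* b :- r) :+ r :* ((con (⁺ 1) :+ r) :* a :- r)
                     := (con (⁺ 1) :+ r) :* (b :+ r :* (a :+ μ)) :- r :* ((con (⁺ 1) :+ r) :* (con (⁺ 1) :+ μ)))
             refl (⁺ r) (⁺ μ) (⁺ a) (⁺ a′) ⟩
  ⁺ suc r ℤ.* (⁺ a′ ℤ.+ ⁺ r ℤ.* (⁺ a ℤ.+ ⁺ μ)) ℤ.- ⁺ r ℤ.* (⁺ suc r ℤ.* ⁺ suc μ)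
    ≡⟨ cong (λ e → ⁺ suc r ℤ.* e ℤ.- ⁺ r ℤ.* (⁺ suc r ℤ.* ⁺ suc μ)) eqℤ ⟩
  ⁺ suc r ℤ.* (⁺ q ℤ.* ⁺ suc μ) ℤ.- ⁺ r ℤ.* (⁺ suc r ℤ.* ⁺ suc μ)
    ≡⟨ solve 4 (λ r k m q → k :* (q :* m) :- r :* (k :* m) := (q :- r) :* (k :* m))
             refl (⁺ r) (⁺ suc r) (⁺ suc μ) (⁺ q) ⟩
  (⁺ q ℤ.- ⁺ r) ℤ.* (⁺ suc r ℤ.* ⁺ suc μ)
    ≡⟨ cong ((⁺ q ℤ.- ⁺ r) ℤ.*_) (ℤ.pos-* (suc r) (suc μ)) ⟨
  (⁺ q ℤ.- ⁺ r) ℤ.* ⁺ (suc r * suc μ) ∎)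
  where
  open ≡-Reasoning
  open ℤ.+-*-Solver
  eqℤ : ⁺ a′ ℤ.+ ⁺ r ℤ.* (⁺ a ℤ.+ ⁺ μ) ≡ ⁺ q ℤ.* ⁺ suc μ
  eqℤ = trans (cong (λ e → ⁺ a′ ℤ.+ e) (sym (ℤ.pos-* r (a + μ)))) (trans (cong ⁺_ eq) (ℤ.pos-* q (suc μ)))

-- Two steps are taken at a time, so the multiplier -r enters only through its square and the power
-- stays a natural number; this is where an even ℓ is used.
iterated-step : ∀ r K (C : ℕ → ℤ) → (∀ j → K ℤ.∣ C (suc j) ℤ.+ ⁺ r ℤ.* C j) →
  ∀ h → K ℤ.∣ C (h * 2) ℤ.- ⁺ ((r * r) ^ h) ℤ.* C 0
iterated-step r K C step zero    = ℤ.divides (⁺ 0) (solve 1 (λ c → c :- con (⁺ 1) :* c := con (⁺ 0)) refl (C 0))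
  where open ℤ.+-*-Solver
iterated-step r K C step (suc h) = subst (K ℤ.∣_) telescope
  (ℤ.∣m∣n⇒∣m+n (ℤ.∣m∣n⇒∣m-n (step (suc (h * 2))) (ℤ.∣n⇒∣m*n (⁺ r) (step (h * 2))))
    (ℤ.∣n⇒∣m*n (⁺ r ℤ.* ⁺ r) (iterated-step r K C step h)))
  where
  open ≡-Reasoning
  open ℤ.+-*-Solver
  c₂ c₁ c₀ : ℤ
  c₂ = C (suc h * 2)
  c₁ = C (suc (h * 2))
  c₀ = C (h * 2)
  s : ℕ
  s  = (r * r) ^ h
  telescope : (c₂ ℤ.+ ⁺ r ℤ.* c₁) ℤ.- ⁺ r ℤ.* (c₁ ℤ.+ ⁺ r ℤ.* c₀) ℤ.+ (⁺ r ℤ.* ⁺ r) ℤ.* (c₀ ℤ.- ⁺ s ℤ.* C 0)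
            ≡ c₂ ℤ.- ⁺ (r * r * s) ℤ.* C 0
  telescope = begin
    _ ≡⟨ solve 6 (λ r x y z s w → (x :+ r :* y) :- r :* (y :+ r :* z) :+ (r :* r) :* (z :- s :* w)
                               := x :- (r :* r :* s) :* w) refl (⁺ r) c₂ c₁ c₀ (⁺ s) (C 0) ⟩
    c₂ ℤ.- (⁺ r ℤ.* ⁺ r ℤ.* ⁺ s) ℤ.* C 0
      ≡⟨ cong (λ e → c₂ ℤ.- e ℤ.* C 0) (trans (ℤ.pos-* (r * r) s) (cong (ℤ._* ⁺ s) (ℤ.pos-* r r))) ⟨
    c₂ ℤ.- ⁺ (r * r * s) ℤ.* C 0 ∎

next-mod : ∀ {m} j → next (j mod suc m) ≡ suc j mod suc m
next-mod {m} j = toℕ-injective (begin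
  toℕ (next (j mod ℓ))                      ≡⟨ toℕ-next (j mod ℓ) ⟩
  suc (toℕ (j mod ℓ)) % ℓ                   ≡⟨ cong (λ e → suc e % ℓ) (toℕ-fromℕ< (m%n<n j ℓ)) ⟩
  (1 + j % ℓ) % ℓ                           ≡⟨ %-distribˡ-+ 1 (j % ℓ) ℓ ⟩
  (1 % ℓ + j % ℓ % ℓ) % ℓ                   ≡⟨ cong (λ e → (1 % ℓ + e) % ℓ) (m%n%n≡m%n j ℓ) ⟩
  (1 % ℓ + j % ℓ) % ℓ                       ≡⟨ %-distribˡ-+ 1 j ℓ ⟨
  suc j % ℓ                                 ≡⟨ toℕ-fromℕ< (m%n<n (suc j) ℓ) ⟨
  toℕ (suc j mod ℓ)                         ∎)
  where
  open ≡-Reasoning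
  ℓ = suc m

n-mod-n : ∀ m → suc m mod suc m ≡ 0 mod suc m
n-mod-n m = toℕ-injective (begin
  toℕ (suc m mod suc m)   ≡⟨ toℕ-fromℕ< (m%n<n (suc m) (suc m)) ⟩
  suc m % suc m           ≡⟨ n%n≡0 (suc m) ⟩
  0                       ≡⟨ toℕ-fromℕ< (m%n<n 0 (suc m)) ⟨
  toℕ (0 mod suc m)       ∎)
  where open ≡-Reasoning

sumGraph-free : ∀ r μ n h m .{{_ : NonZero r}} → suc (suc m) ≡ h * 2 → (r * r) ^ h ≡ suc (suc μ) →
  ZycleFree (suc (suc m)) (sumGraph r (suc μ) n)
sumGraph-free r μ n h m ℓ≡ pow Z = contradiction (∣⇒≤ (ℤ.∣⇒∣ᵤ k∣r)) (<⇒≱ (n<1+n r))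
  where
  open ℤ.+-*-Solver
  M ℓ : ℕ
  M = suc μ
  ℓ = suc (suc m)
  rowSum : Fin ℓ → ℕ
  rowSum i = ∑ (allFin r) (λ j → toℕ (proj₁ Z (i , j)))
  -- Around the zycle the row sums satisfy a′ ≡ r − r a modulo M; the shift k a − r turns this into c′ ≡ − r c modulo k M.
  shifted : Fin ℓ → ℤ
  shifted i = ⁺ suc r ℤ.* ⁺ rowSum i ℤ.- ⁺ r
  C : ℕ → ℤ
  C j = shifted (j mod ℓ)
  shifted-step : ∀ i → ⁺ (suc r * M) ℤ.∣ shifted (next i) ℤ.+ ⁺ r ℤ.* shifted i
  shifted-step i with divides q eq ← sumGraph-zycle r M n Z i =
    affine-step r μ q (rowSum i) (rowSum (next i)) eq
  C-step : ∀ j → ⁺ (suc r * M) ℤ.∣ C (suc j) ℤ.+ ⁺ r ℤ.* C j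
  C-step j = subst (λ i → ⁺ (suc r * M) ℤ.∣ shifted i ℤ.+ ⁺ r ℤ.* C j) (next-mod j) (shifted-step (j mod ℓ))
  C-periodic : C (h * 2) ≡ C 0
  C-periodic = trans (cong C (sym ℓ≡)) (cong shifted (n-mod-n (suc m)))
  -- After ℓ = 2 h steps C is back at its start, and r^ℓ = M + 1, so the divisible difference C 0 -
  -- r^ℓ C 0 equals - C 0 · M.
  kM∣ : ⁺ suc r ℤ.* ⁺ M ℤ.∣ (ℤ.- C 0) ℤ.* ⁺ M
  kM∣ = subst₂ ℤ._∣_ (ℤ.pos-* (suc r) M)
    (trans (cong₂ (λ x y → x ℤ.- ⁺ y ℤ.* C 0) C-periodic pow)
      (solve 2 (λ c M → c :- (con (⁺ 1) :+ M) :* c := (:- c) :* M) refl (C 0) (⁺ M)))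
    (iterated-step r (⁺ (suc r * M)) C C-step h)
  k∣r : ⁺ suc r ℤ.∣ ⁺ r
  k∣r = subst (⁺ suc r ℤ.∣_)
    (solve 3 (λ k a r → (:- (k :* a :- r)) :+ k :* a := r) refl (⁺ suc r) (⁺ rowSum (0 mod ℓ)) (⁺ r))
    (ℤ.∣m∣n⇒∣m+n (ℤ.*-cancelʳ-∣ (⁺ M) {⁺ suc r} {ℤ.- C 0} kM∣) (ℤ.∣m⇒∣m*n (⁺ rowSum (0 mod ℓ)) ℤ.∣-refl))

-- Passing to rational densities

-- Inequalities with rational factors are verified among unnormalised fractions, where
-- cross-multiplication meets no reduction to lowest terms.
toℚᵘ-scale : ∀ p n → ℚ.toℚᵘ (ℚ.fromℚᵘ p ℚ.* toℚ n) ℚᵘ.≃ p ℚᵘ.* mkℚᵘ (⁺ n) 0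
toℚᵘ-scale p n = ℚᵘ.≃-trans (ℚ.toℚᵘ-homo-* (ℚ.fromℚᵘ p) (toℚ n))
  (ℚᵘ.*-cong (ℚ.toℚᵘ-fromℚᵘ p) (ℚ.toℚᵘ-fromℚᵘ (mkℚᵘ (⁺ n) 0)))

scale≤ : ∀ a x n D → a * n ≤ suc x * D → ℚ.fromℚᵘ (mkℚᵘ (⁺ a) x) ℚ.* toℚ n ≤ℚ toℚ D
scale≤ a x n D le = ℚ.toℚᵘ-cancel-≤ (begin
  ℚ.toℚᵘ (ℚ.fromℚᵘ (mkℚᵘ (⁺ a) x) ℚ.* toℚ n)   ≃⟨ toℚᵘ-scale (mkℚᵘ (⁺ a) x) n ⟩
  mkℚᵘ (⁺ a) x ℚᵘ.* mkℚᵘ (⁺ n) 0              ≤⟨ *≤* cross ⟩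
  mkℚᵘ (⁺ D) 0                                ≃⟨ ℚ.toℚᵘ-fromℚᵘ (mkℚᵘ (⁺ D) 0) ⟨
  ℚ.toℚᵘ (toℚ D)                              ∎)
  where
  open ℚᵘ.≤-Reasoning
  cross : (⁺ a ℤ.* ⁺ n) ℤ.* ⁺ 1 ℤ.≤ ⁺ D ℤ.* ⁺ suc (x * 1)
  cross = subst₂ ℤ._≤_
    (trans (ℤ.pos-* a n) (sym (ℤ.*-identityʳ _)))
    (trans (ℤ.pos-* D (suc (x * 1))) refl)
    (ℤ.+≤+ (≤-trans le (≤-reflexive (trans (*-comm (suc x) D) (cong (λ e → D * suc e) (sym (*-identityʳ x)))))))

≤scale : ∀ a x n D → suc x * D ≤ a * n → toℚ D ≤ℚ ℚ.fromℚᵘ (mkℚᵘ (⁺ a) x) ℚ.* toℚ n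
≤scale a x n D le = ℚ.toℚᵘ-cancel-≤ (begin
  ℚ.toℚᵘ (toℚ D)                              ≃⟨ ℚ.toℚᵘ-fromℚᵘ (mkℚᵘ (⁺ D) 0) ⟩
  mkℚᵘ (⁺ D) 0                                ≤⟨ *≤* cross ⟩
  mkℚᵘ (⁺ a) x ℚᵘ.* mkℚᵘ (⁺ n) 0              ≃⟨ toℚᵘ-scale (mkℚᵘ (⁺ a) x) n ⟨
  ℚ.toℚᵘ (ℚ.fromℚᵘ (mkℚᵘ (⁺ a) x) ℚ.* toℚ n)   ∎)
  where
  open ℚᵘ.≤-Reasoning
  cross : ⁺ D ℤ.* ⁺ suc (x * 1) ℤ.≤ (⁺ a ℤ.* ⁺ n) ℤ.* ⁺ 1
  cross = subst₂ ℤ._≤_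
    (ℤ.pos-* D (suc (x * 1)))
    (trans (ℤ.pos-* a n) (sym (ℤ.*-identityʳ _)))
    (ℤ.+≤+ (≤-trans (≤-reflexive (trans (cong (λ e → D * suc e) (*-identityʳ x)) (*-comm D (suc x)))) le))

*-toℚ-monoˡ-≤ : ∀ n {p q} → p ≤ℚ q → p ℚ.* toℚ n ≤ℚ q ℚ.* toℚ n
*-toℚ-monoˡ-≤ n = ℚ.*-monoʳ-≤-nonNeg (toℚ n) {{ℚ.normalize-nonNeg n 1}}

lowerBound≤ : ∀ k ℓ n D .{{_ : NonZero (k ∸ 1)}} → n ≤ 2 * (k ∸ 1) ^ ℓ * D → lowerBound k ℓ ℚ.* toℚ n ≤ℚ toℚ D
-- The nonzero denominator rules out the default branch `0ℚ` of `lowerBound`.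
lowerBound≤ k ℓ n D le with 2 * (k ∸ 1) ^ ℓ | m*n≢0 2 ((k ∸ 1) ^ ℓ) {{_}} {{m^n≢0 (k ∸ 1) ℓ}}
... | suc x | _ = scale≤ 1 x n D (≤-trans (≤-reflexive (+-identityʳ n)) le)

-- The factor 2 absorbs both the rounding in n / M and the loss of r: once n / M ≥ 2k, the codegree
-- bound D = n / M - r is at least k = r + 1, hence n / M + 1 = D + k ≤ 2 D.
sumGraph-density : ∀ r M n .{{_ : NonZero M}} → (2 * suc r) * M ≤ n → n ≤ 2 * M * (n / M ∸ r)
sumGraph-density r M n le = begin
  n                            ≡⟨ m≡m%n+[m/n]*n n M ⟩
  n % M + n / M * M            ≤⟨ +-monoˡ-≤ (n / M * M) (<⇒≤ (m%n<n n M)) ⟩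
  suc (n / M) * M              ≤⟨ *-monoˡ-≤ M quotient≤ ⟩
  (D + D) * M                  ≡⟨ solve 2 (λ D M → (D :+ D) :* M := con 2 :* M :* D) refl D M ⟩
  2 * M * D                    ∎
  where
  open ≤-Reasoning
  open +-*-Solver
  D : ℕ
  D = n / M ∸ r
  2k≤n/M : 2 * suc r ≤ n / M
  2k≤n/M = ≤-trans (≤-reflexive (sym (m*n/n≡m (2 * suc r) M))) (/-monoˡ-≤ M le)
  D+r : D + r ≡ n / M
  D+r = m∸n+n≡m (≤-trans (≤-trans (n≤1+n r) (m≤m+n (suc r) _)) 2k≤n/M)
  k≤D : suc r ≤ D
  k≤D = m+n≤o⇒m≤o∸n (suc r) (≤-trans (+-monoʳ-≤ (suc r) (≤-trans (n≤1+n r) (m≤m+n (suc r) 0))) 2k≤n/M)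
  quotient≤ : suc (n / M) ≤ D + D
  quotient≤ = ≤-trans (≤-reflexive (trans (cong suc (sym D+r)) (sym (+-suc D r)))) (+-monoʳ-≤ D k≤D)

γ≥-lowerBound : ∀ r h → 2 ≤ r → γ≥ (suc r) (suc h * 2) (lowerBound (suc r) (suc h * 2))
γ≥-lowerBound r h 2≤r ε 0<ε = 2 * suc r * M , λ n n≥ →
  sumGraph r M n , sumGraph-free r μ n (suc h) (h * 2) refl power , n / M ∸ r , sumGraph-δ r M n ,
  ℚ.≤-trans (*-toℚ-monoˡ-≤ n c-ε≤c)
    (lowerBound≤ (suc r) (suc h * 2) n (n / M ∸ r) (≤-trans (sumGraph-density r M n n≥) (*-monoˡ-≤ (n / M ∸ r) (*-monoʳ-≤ 2 M≤))))
  where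
  open ≤-Reasoning
  instance
    r≢0 : NonZero r
    r≢0 = >-nonZero (≤-trans (s≤s z≤n) 2≤r)
    rr≢0 : NonZero (r * r)
    rr≢0 = m*n≢0 r r
  c = lowerBound (suc r) (suc h * 2)
  X μ M : ℕ
  X = (r * r) ^ suc h
  -- Thus M = r^ℓ - 1 has the form of a successor; `power` needs r^ℓ ≥ 2 for this.
  μ = pred (pred X)
  M = suc μ
  2≤X : 2 ≤ X
  2≤X = begin
    2                        ≤⟨ 2≤r ⟩
    r                        ≤⟨ m≤m*n r r ⟩
    r * r                    ≤⟨ m≤m*n (r * r) ((r * r) ^ h) {{m^n≢0 (r * r) h}} ⟩
    X                        ∎
  power : X ≡ suc M
  power = sym (trans (cong suc (suc-pred (pred X) {{>-nonZero (<⇒≤pred 2≤X)}})) (suc-pred X {{>-nonZero (<⇒≤ 2≤X)}}))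
  M≤ : M ≤ r ^ (suc h * 2)
  M≤ = begin
    M                    ≤⟨ n≤1+n M ⟩
    suc M                ≡⟨ power ⟨
    (r * r) ^ suc h      ≡⟨ cong (λ e → (r * e) ^ suc h) (*-identityʳ r) ⟨
    (r ^ 2) ^ suc h      ≡⟨ ^-*-assoc r 2 (suc h) ⟩
    r ^ (2 * suc h)      ≡⟨ cong (r ^_) (*-comm 2 (suc h)) ⟩
    r ^ (suc h * 2)      ∎
  c-ε≤c : c ℚ.- ε ≤ℚ c
  c-ε≤c = ℚ.≤-trans (ℚ.+-monoʳ-≤ c (ℚ.neg-antimono-≤ (ℚ.<⇒≤ 0<ε))) (ℚ.≤-reflexive (ℚ.+-identityʳ c))

-- A positive rational is at least the reciprocal of its denominator, so it suffices to find zycles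
-- at codegree n/q with q one more than the denominator. The extra one guarantees q ≥ 2, as
-- `dense⇒zycle` demands.
reciprocal≤⇒γ≤ : ∀ k ℓ d → 0ℚ <ℚ d → ∀ N →
  (∀ n → N ≤ n → (H : KGraph k n) → ∀ D → δ≥ H D → n ≤ suc (ℚ.↧ₙ d) * D → ContainsZycle ℓ H) → γ≤ k ℓ d
reciprocal≤⇒γ≤ k ℓ (mkℚ -[1+ _ ] _ _) (ℚ.*<* ())
reciprocal≤⇒γ≤ k ℓ (mkℚ (⁺ zero) _ _) (ℚ.*<* (ℤ.+<+ ()))
reciprocal≤⇒γ≤ k ℓ d@(mkℚ (⁺ suc a) x _) 0<d N zycle ε 0<ε = N , λ n n≥ H free D δ →
  ℚ.≤-trans (subst (λ e → toℚ D ≤ℚ e ℚ.* toℚ n) (ℚ.fromℚᵘ-toℚᵘ d)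
      (≤scale (suc a) x n D (small n D (λ n≤ → free (zycle n n≥ H D δ n≤)))))
    (*-toℚ-monoˡ-≤ n d≤d+ε)
  where
  small : ∀ n D → ¬ (n ≤ suc (suc x) * D) → suc x * D ≤ suc a * n
  small n D n≰ = ≤-trans (*-monoˡ-≤ D (n≤1+n (suc x))) (≤-trans (≰⇒≥ n≰) (m≤m+n n (a * n)))
  d≤d+ε : d ≤ℚ d ℚ.+ ε
  d≤d+ε = ℚ.≤-trans (ℚ.≤-reflexive (sym (ℚ.+-identityʳ d))) (ℚ.+-monoʳ-≤ d (ℚ.<⇒≤ 0<ε))

theorem1p4 : (k : ℕ) → 3 ≤ k → (d : ℚ) → 0ℚ <ℚ d → d ≤ℚ 1ℚ →
    ∃[ ℓ ] (2 ≤ ℓ × γ≥ k ℓ (lowerBound k ℓ) × γ≤ k ℓ d)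
theorem1p4 (suc r) (s≤s 2≤r) d 0<d _ =
  suc h * 2 , s≤s (s≤s z≤n) , γ≥-lowerBound r h 2≤r ,
  reciprocal≤⇒γ≤ (suc r) (suc h * 2) d 0<d (proj₁ upper) (proj₂ upper)
  where
  sample = dense⇒zycle r (suc (ℚ.↧ₙ d)) {{>-nonZero (≤-trans (s≤s z≤n) 2≤r)}} (s≤s (s≤s z≤n))
  t h : ℕ
  t = proj₁ sample
  -- Then `suc h * 2` is 2 · t!: even for the lower bound, a multiple of t! for the upper bound, and
  -- visibly at least 2.
  h = pred (t !)
  upper = proj₂ (proj₂ sample) (suc (h * 2)) (divides 2 (trans (cong (_* 2) (suc-pred (t !) {{t !≢0}})) (*-comm (t !) 2)))
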